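{- Let $p$ be a prime and let $d,w$ be positive integers such that $w\mid p^d+1$. Put $z_1=\frac{p^d+1}{w}$ and let $z_2\in\{w-1,w\}$. Then there exists a uniform $(z_1,p^{2d},k,\lambda,\mu,t)$-partial sum family $\{S_{i,j}\}_{0\le i,j\le z_1-1}$ (in some finite abelian group of order $p^{2d}$) with $$k=(p^d-1)w+(z_1-1)z_2p^d,\quad \lambda=p^d+w^2-3w+(z_1-1)z_2^2,$$ $$\mu=w^2-w+(z_1-1)z_2^2,\quad t=p^dw-w+(z_1-1)z_2^2.$$
   Context: Let $G$ be a finite abelian group of order $n$, written additively, with identity $0$. A subset $S\subseteq G$ is identified with the element $\sum_{g\in S}g$ of the group ring $\mathbb{Z}[G]$. A family $\{S_{i,j}\}_{0\le i,j\le m-1}$ of subsets of $G$ is an $(m,n,k,\lambda,\mu,t)$-partial sum family if (1) $0\notin S_{i,i}$ for all $i$; (2) $\sum_{j=0}^{m-1}|S_{i,j}|=\sum_{j=0}^{m-1}|S_{j,i}|=k$ for all $i$; (3) for all $0\le i,j\le m-1$, in $\mathbb{Z}[G]$ one has $\sum_{l=0}^{m-1}S_{l,j}S_{i,l}=\mu G+\beta S_{i,j}+\delta_{i,j}\gamma e$, where $e$ is the group identity viewed in $\mathbb{Z}[G]$, $\beta=\lambda-\mu$, $\gamma=t-\mu$ and $\delta_{i,j}$ is the Kronecker delta. Such a family is uniform if: the sizes $|S_{i,i}|$ are all equal; the sizes $|S_{i,j}|$ with $i\neq j$ are all equal; and $\{S_{i,i}:0\le i\le m-1\}$ is a partition of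 $G\setminus\{0\}$. -}

module Defs where

open import Algebra.Bundles using (AbelianGroup)
open import Algebra.Bundles.Raw using (RawMonoid)
import Algebra.Definitions.RawMonoid as RawMonoidSum
import Algebra.Properties.CommutativeMonoid.Sum as CommutativeMonoidSum
open import Data.Bool.Base using (Bool; true; T; if_then_else_)
open import Data.Fin.Base using (Fin)
import Data.Fin.Properties as Fin
open import Data.Integer.Base as ℤ using (ℤ; +_; 0ℤ; 1ℤ)
import Data.Integer.Properties as ℤ
open import Data.Nat.Base as ℕ using (ℕ)
import Data.Nat.Properties as ℕ
open import Data.Product.Base using (_×_; ∃)
open import Function.Bundles using (Func; Inverse; _⟶ₛ_; _⟨$⟩_; _⇔_)
open import Level using (0ℓ)
open import Relation.Binary.Definitions using (Decidable)
open import Relation.Binary.PropositionalEquality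
  using (_≡_; _≢_; refl; cong; cong₂; setoid)
open import Relation.Nullary.Decidable using (does; map′)
open import Relation.Nullary.Negation using (¬_)

record FiniteAbelianGroup (n : ℕ) : Set₁ where
  field
    abelianGroup : AbelianGroup 0ℓ 0ℓ

  open AbelianGroup abelianGroup public
    using (Carrier; _≈_)
    renaming
    ( _∙_ to _+_ ; ε to 0# ; _⁻¹ to -_ ; setoid to ≈-setoid
    ; ∙-congʳ to +-congʳ ; refl to ≈-refl ; sym to ≈-sym ; trans to ≈-trans
    )

  field
    enumeration : Inverse (setoid (Fin n)) ≈-setoid

  elem : Fin n → Carrier
  elem = Inverse.to enumeration

  index : Carrier → Fin n
  index = Inverse.from enumeration

  index-cong : ∀ {x y} → x ≈ y → index x ≡ index y
  index-cong = Inverse.from-cong enumeration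

  index-injective : ∀ {x y} → index x ≡ index y → x ≈ y
  index-injective {x} {y} eq =
    ≈-trans (≈-sym (Inverse.inverseˡ enumeration refl))
            (Inverse.inverseˡ enumeration eq)

  _≟_ : Decidable _≈_
  x ≟ y = map′ index-injective index-cong (index x Fin.≟ index y)


module FiniteSubset {n : ℕ} (G : FiniteAbelianGroup n) where

  open FiniteAbelianGroup G

  -- Subsets of a finite group are given by their characteristic functions,
  -- which must respect the equality of the group.
  Subset : Set
  Subset = ≈-setoid ⟶ₛ setoid Bool

  infix 4 _∈_ _∉_

  _∈_ : Carrier → Subset → Set
  x ∈ S = T (S ⟨$⟩ x)

  _∉_ : Carrier → Subset → Set
  x ∉ S = ¬ (x ∈ S)

  size : Subset → ℕ
  size S = sum (λ i → if S ⟨$⟩ elem i then 1 else 0)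
    where open CommutativeMonoidSum ℕ.+-0-commutativeMonoid using (sum)

  full : Subset
  full = record { to = λ _ → true ; cong = λ _ → refl }

  ｛_｝ : Carrier → Subset
  ｛ g ｝ = record
    { to   = λ x → does (x ≟ g)
    ; cong = λ x≈y → cong (λ i → does (i Fin.≟ index g)) (index-cong x≈y)
    }


module GroupRing {n : ℕ} (G : FiniteAbelianGroup n) where

  open FiniteAbelianGroup G
  open FiniteSubset G using (Subset)

  -- An element Σ_g a_g g of ℤ[G] is represented by its coefficient
  -- function g ↦ a_g.
  ℤ[G] : Set
  ℤ[G] = ≈-setoid ⟶ₛ setoid ℤ

  infix  4 _≋_
  infixl 6 _⊕_
  infixl 7 _⊛_ _·_

  _≋_ : ℤ[G] → ℤ[G] → Set
  a ≋ b = ∀ x → a ⟨$⟩ x ≡ b ⟨$⟩ x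

  𝟘 : ℤ[G]
  𝟘 = record { to = λ _ → 0ℤ ; cong = λ _ → refl }

  _⊕_ : ℤ[G] → ℤ[G] → ℤ[G]
  a ⊕ b = record
    { to   = λ x → (a ⟨$⟩ x) ℤ.+ (b ⟨$⟩ x)
    ; cong = λ x≈y → cong₂ ℤ._+_ (Func.cong a x≈y) (Func.cong b x≈y)
    }

  _·_ : ℤ → ℤ[G] → ℤ[G]
  c · a = record
    { to   = λ x → c ℤ.* (a ⟨$⟩ x)
    ; cong = λ x≈y → cong (c ℤ.*_) (Func.cong a x≈y)
    }

  -- (Σ_g a_g g)(Σ_h b_h h) = Σ_x (Σ_g a_g b_{x-g}) x
  _⊛_ : ℤ[G] → ℤ[G] → ℤ[G]
  a ⊛ b = record
    { to   = λ x → sum (λ i → (a ⟨$⟩ elem i) ℤ.* (b ⟨$⟩ (x + (- elem i))))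
    ; cong = λ x≈y → sum-cong-≗ (λ i →
               cong ((a ⟨$⟩ elem i) ℤ.*_) (Func.cong b (+-congʳ x≈y)))
    }
    where open CommutativeMonoidSum ℤ.+-0-commutativeMonoid using (sum; sum-cong-≗)

  ⊕-rawMonoid : RawMonoid 0ℓ 0ℓ
  ⊕-rawMonoid = record { Carrier = ℤ[G] ; _≈_ = _≋_ ; _∙_ = _⊕_ ; ε = 𝟘 }

  ∑ : ∀ {m} → (Fin m → ℤ[G]) → ℤ[G]
  ∑ = RawMonoidSum.sum ⊕-rawMonoid

  -- A subset S is identified with Σ_{g ∈ S} g.
  ⟦_⟧ : Subset → ℤ[G]
  ⟦ S ⟧ = record
    { to   = λ x → if S ⟨$⟩ x then 1ℤ else 0ℤ
    ; cong = λ x≈y → cong (if_then 1ℤ else 0ℤ) (Func.cong S x≈y)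
    }


δ : ∀ {m} → Fin m → Fin m → ℤ
δ i j = if does (i Fin.≟ j) then 1ℤ else 0ℤ

record PartialSumFamily (m n : ℕ) (k λ′ μ t : ℤ) : Set₁ where
  field
    group : FiniteAbelianGroup n

  open FiniteAbelianGroup group public using (Carrier; _≈_; 0#)
  open FiniteSubset group public
  open GroupRing group public
  open CommutativeMonoidSum ℕ.+-0-commutativeMonoid using (sum)

  β : ℤ
  β = λ′ ℤ.- μ

  γ : ℤ
  γ = t ℤ.- μ

  field
    S        : Fin m → Fin m → Subset
    0∉S      : ∀ i → 0# ∉ S i i
    row-size : ∀ i → + sum (λ j → size (S i j)) ≡ k
    col-size : ∀ i → + sum (λ j → size (S j i)) ≡ k
    product  : ∀ i j →
      ∑ (λ l → ⟦ S l j ⟧ ⊛ ⟦ S i l ⟧)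
        ≋ μ · ⟦ full ⟧ ⊕ β · ⟦ S i j ⟧ ⊕ (δ i j ℤ.* γ) · ⟦ ｛ 0# ｝ ⟧

record Uniform {m n k λ′ μ t} (F : PartialSumFamily m n k λ′ μ t) : Set where
  open PartialSumFamily F
  field
    diagonal-size     : ∀ i i′ → size (S i i) ≡ size (S i′ i′)
    off-diagonal-size : ∀ i j i′ j′ → i ≢ j → i′ ≢ j′ →
                        size (S i j) ≡ size (S i′ j′)

    -- The sets S i i partition G ∖ {0}; blocks of a partition are nonempty.
    nonempty : ∀ i → ∃ λ x → x ∈ S i i
    disjoint : ∀ i i′ → i ≢ i′ → ∀ x → ¬ (x ∈ S i i × x ∈ S i′ i′)
    covers   : ∀ x → (¬ (x ≈ 0#)) ⇔ (∃ λ i → x ∈ S i i)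

module Submission where

-- Let K be the field of order q = p^d and G = K². The q + 1 lines through 0 are divided into
-- z₁ classes of w lines each. S_{i,i} is the union of the lines of class i without 0, and, for
-- j ≠ i, S_{i,j} is a union of z₂ parallel translates of one fixed line of class i, the same
-- for all j. For lines L ≠ L′ one has LL′ = G in ℤ[G], while LL = qL, and so
--   S_{i,i}S_{i,i} = (q - 2w) S_{i,i} + (w² - w) G + (qw - w²) e,
--   S_{l,j}S_{i,l} = z₂² G  for l ≠ i, j,
--   S_{j,j}S_{i,j} + S_{i,j}S_{i,i} = (q - 2w) S_{i,j} + (2w - 1) z₂ G  for i ≠ j.
-- The identities required of the family reduce to
-- (z₂ - w)(z₂ - w + 1) = 0.
--
-- K is a quotient of 𝔽_p[X]/(X^(q-1) - 1), in which a^q = a for all a: there every non-zero a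
-- becomes a root of unity after passing to the ideal it generates, so finitely many such steps
-- lead to a field. Starting from the ideal generated by the nonzero element
-- ∏_{0<e<d} (X^(p^e) - X) ensures that X has d distinct conjugates, whence |K| = q.

open import Defs
open import Algebra.Bundles using (AbelianGroup; CommutativeRing; RawRing)
import Algebra.Construct.Pointwise as Pointwise
import Algebra.Morphism.RingMonomorphism as RingMonomorphism
open import Algebra.Morphism.Structures using (IsRingMonomorphism)
import Algebra.Properties.AbelianGroup as AbelianGroupProperties
import Algebra.Properties.CommutativeMonoid.Sum as CommutativeMonoidSum
import Algebra.Properties.CommutativeSemigroup as CommutativeSemigroupProperties
import Algebra.Properties.CommutativeSemiring.Binomial as Binomial
import Algebra.Properties.CommutativeSemiring.Exp as Exp
import Algebra.Properties.Group as GroupProperties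
import Algebra.Properties.Ring as RingProperties
import Algebra.Properties.Semiring.Mult as Mult
import Algebra.Properties.Semiring.Sum as SemiringSum
import Algebra.Solver.Ring.NaturalCoefficients.Default as SemiringSolver
open import Algebra.Structures using (IsCommutativeRing)
open import Data.Bool.Base using (Bool; true; false; T; not; _∧_; if_then_else_)
open import Data.Fin.Base as Fin
  using (Fin; zero; suc; toℕ; fromℕ; fromℕ<; inject₁; cast; combine; remQuot; punchOut; finToFun; funToFin)
import Data.Fin.Properties as Fin
open import Data.Integer.Base as ℤ using (ℤ; +_; 0ℤ; 1ℤ)
import Data.Integer.DivMod as ℤ
import Data.Integer.Divisibility.Signed as ℤ∣
import Data.Integer.Properties as ℤ
open import Data.Integer.Tactic.RingSolver using (solve-∀)
open import Data.Nat.Base as ℕ using (ℕ; zero; suc; NonZero; s≤s; z≤n)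
open import Data.Nat.Combinatorics using (_C_; nCn≡1; nC1≡n; nCk≡nC[n∸k]; k>n⇒nCk≡0; nCk+nC[k+1]≡[n+1]C[k+1])
open import Data.Nat.Coprimality using (prime⇒coprime; coprime-Bézout)
open import Data.Nat.Divisibility as ℕ∣ using (_∣_; divides)
open import Data.Nat.DivMod using (_%_; _/_; [m+n]%n≡m%n; m<n⇒m%n≡m; m%n<n; m≡m%n+[m/n]*n; m/n*n≡m)
open import Data.Nat.GCD using (module Bézout)
open import Data.Nat.Primality using (Prime; euclidsLemma; prime⇒nonZero; prime⇒nonTrivial)
import Data.Nat.Properties as ℕ
open import Data.Nat.Solver using (module +-*-Solver)
open import Data.Product.Base using (∃; Σ; _×_; _,_; proj₁; proj₂; uncurry)
open import Data.Sum.Base as Sum using (_⊎_; inj₁; inj₂)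
open import Function.Base using (_∘_)
open import Function.Bundles using (Inverse; _⟨$⟩_; mk⇔; mk↔ₛ′)
open import Function.Definitions using (Injective)
open import Level using (0ℓ)
open import Relation.Binary.Definitions using (tri<; tri≈; tri>)
open import Relation.Binary.PropositionalEquality as ≡ using (_≡_; _≢_; refl)
open import Relation.Nullary.Decidable using (Dec; yes; no; does; map′; dec-true; dec-false)
open import Relation.Nullary.Negation using (¬_; contradiction)

-- The quadratic condition comes from the entries with i ≠ j. There the terms l = i and l = j
-- contribute (2w - 1) z₂ G and each of the other z₁ - 2 terms contributes z₂² G, while μ = w² - w +
-- (z₁ - 1) z₂² is already forced by the diagonal entries. One direction per class suffices off the
-- diagonal, because S_{l,j} and S_{i,l} are multiplied with l ≠ i, so their lines belong to
-- different classes and the product is a multiple of G. For K the obstacle is to get a maximal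
-- ideal constructively, with no irreducible polynomial of degree d at hand. Polynomials are
-- compared only through their action on one sequence s. Passing to the ideal generated by a then
-- just replaces s by `act a s`, and nothing has to be reduced to a normal form. Each step keeps s
-- nonzero, and a decision procedure on finitely many entries of s drives it. A field reached in
-- this way could still be too small, with X in a proper subfield of K. Turning every X^(p^e) - X
-- into a unit beforehand excludes this, and there is room for it because p + ... + p^(d-1) ≤ q - 2.

-- Binomial coefficients and the Frobenius map in characteristic p.

[1+k]*[1+n]C[1+k]≡[1+n]*nCk : ∀ n k → suc k ℕ.* (suc n C suc k) ≡ suc n ℕ.* (n C k)
[1+k]*[1+n]C[1+k]≡[1+n]*nCk n zero = begin
  1 ℕ.* (suc n C 1)      ≡⟨ ℕ.*-identityˡ _ ⟩
  suc n C 1              ≡⟨ nC1≡n (suc n) ⟩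
  suc n                  ≡⟨ ℕ.*-identityʳ _ ⟨
  suc n ℕ.* 1            ≡⟨ ≡.cong (suc n ℕ.*_) (≡.trans (nCk≡nC[n∸k] {0} {n} ℕ.z≤n) (nCn≡1 n)) ⟨
  suc n ℕ.* (n C 0)      ∎
  where open ≡.≡-Reasoning
[1+k]*[1+n]C[1+k]≡[1+n]*nCk zero (suc k) = begin
  (2 ℕ.+ k) ℕ.* (1 C (2 ℕ.+ k))  ≡⟨ ≡.cong ((2 ℕ.+ k) ℕ.*_) (k>n⇒nCk≡0 {1} {2 ℕ.+ k} (s≤s (s≤s ℕ.z≤n))) ⟩
  (2 ℕ.+ k) ℕ.* 0                ≡⟨ ℕ.*-zeroʳ (2 ℕ.+ k) ⟩
  1 ℕ.* 0                        ≡⟨ ≡.cong (1 ℕ.*_) (k>n⇒nCk≡0 {0} {suc k} (s≤s ℕ.z≤n)) ⟨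
  1 ℕ.* (0 C suc k)              ∎
  where open ≡.≡-Reasoning
[1+k]*[1+n]C[1+k]≡[1+n]*nCk (suc n) (suc k) = begin
  (2 ℕ.+ k) ℕ.* ((2 ℕ.+ n) C (2 ℕ.+ k))
    ≡⟨ ≡.cong ((2 ℕ.+ k) ℕ.*_) (nCk+nC[k+1]≡[n+1]C[k+1] (suc n) (suc k)) ⟨
  (2 ℕ.+ k) ℕ.* (b ℕ.+ c)
    ≡⟨ solve 3 (λ K B C → (con 2 :+ K) :* (B :+ C) := (con 1 :+ K) :* B :+ B :+ (con 2 :+ K) :* C) refl k b c ⟩
  suc k ℕ.* b ℕ.+ b ℕ.+ (2 ℕ.+ k) ℕ.* c
    ≡⟨ ≡.cong₂ (λ u v → u ℕ.+ b ℕ.+ v)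
         ([1+k]*[1+n]C[1+k]≡[1+n]*nCk n k) ([1+k]*[1+n]C[1+k]≡[1+n]*nCk n (suc k)) ⟩
  suc n ℕ.* (n C k) ℕ.+ b ℕ.+ suc n ℕ.* (n C suc k)
    ≡⟨ solve 4 (λ N X B Y → (con 1 :+ N) :* X :+ B :+ (con 1 :+ N) :* Y := (con 1 :+ N) :* (X :+ Y) :+ B)
         refl n (n C k) b (n C suc k) ⟩
  suc n ℕ.* (n C k ℕ.+ n C suc k) ℕ.+ b
    ≡⟨ ≡.cong (λ u → suc n ℕ.* u ℕ.+ b) (nCk+nC[k+1]≡[n+1]C[k+1] n k) ⟩
  suc n ℕ.* b ℕ.+ b
    ≡⟨ ℕ.+-comm (suc n ℕ.* b) b ⟩
  (2 ℕ.+ n) ℕ.* b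
    ∎
  where
  open ≡.≡-Reasoning
  open +-*-Solver
  b = suc n C suc k
  c = suc n C (2 ℕ.+ k)

-- By the absorption identity p divides k times the binomial coefficient, and p does not divide k.
prime∣C : ∀ {p k} → Prime p → 0 ℕ.< k → k ℕ.< p → p ∣ p C k
prime∣C {suc p} {suc k} prime-p _ k<p
  with euclidsLemma (suc k) (suc p C suc k) prime-p
         (≡.subst (suc p ∣_) (≡.sym ([1+k]*[1+n]C[1+k]≡[1+n]*nCk p k)) (ℕ∣.m∣m*n (p C k)))
... | inj₁ p∣k = contradiction p∣k (ℕ∣.>⇒∤ k<p)
... | inj₂ p∣C = p∣C

module _ {c ℓ} (R : CommutativeRing c ℓ) where

  open CommutativeRing R hiding (zero) renaming (refl to ≈-refl)

  module PrimeCharacteristic {p} (prime-p : Prime p) (p×1≈0 : Mult._×_ semiring p 1# ≈ 0#) where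

    open Exp commutativeSemiring
    open Mult semiring hiding (_×_)
    open Mult semiring using () renaming (_×_ to _·_)
    open SemiringSum semiring using (sum; sum-cong-≋; sum-init-last; sum-replicate-zero)
    open import Relation.Binary.Reasoning.Setoid setoid

    n×0≈0 : ∀ n → n · 0# ≈ 0#
    n×0≈0 zero    = ≈-refl
    n×0≈0 (suc n) = trans (+-identityˡ _) (n×0≈0 n)

    p×x≈0 : ∀ x → p · x ≈ 0#
    p×x≈0 x = begin
      p · x          ≈⟨ ×-congʳ p (*-identityˡ x) ⟨
      p · (1# * x)   ≈⟨ ×-assoc-* p 1# x ⟨
      (p · 1#) * x   ≈⟨ *-congʳ p×1≈0 ⟩
      0# * x         ≈⟨ zeroˡ x ⟩
      0#             ∎

    p∣n⇒n×x≈0 : ∀ {n} x → p ∣ n → n · x ≈ 0#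
    p∣n⇒n×x≈0 x (divides q refl) = begin
      (q ℕ.* p) · x  ≈⟨ ×-assocˡ x q p ⟨
      q · (p · x)    ≈⟨ ×-congʳ q (p×x≈0 x) ⟩
      q · 0#         ≈⟨ n×0≈0 q ⟩
      0#             ∎

    frobenius-+ : ∀ x y → (x + y) ^ p ≈ x ^ p + y ^ p
    frobenius-+ x y = go p prime-p (λ 0<k k<p → p∣n⇒n×x≈0 _ (prime∣C prime-p 0<k k<p))
      where
      open Binomial commutativeSemiring using (binomialTerm; theorem)
      -- `p` is a module parameter and cannot be split into a successor. The claim is restated for a
      -- variable `n`, with the vanishing of the interior terms as a hypothesis.
      go : ∀ n → Prime n → (∀ {k z} → 0 ℕ.< k → k ℕ.< n → (n C k) · z ≈ 0#) →
           (x + y) ^ n ≈ x ^ n + y ^ n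
      go (suc n) _ interior = begin
        (x + y) ^ suc n                          ≈⟨ theorem (suc n) x y ⟩
        t zero + sum (λ k → t (suc k))           ≈⟨ +-cong first (sum-init-last (λ k → t (suc k))) ⟩
        y ^ suc n + (sum (λ k → t (suc (inject₁ k))) + t (suc (fromℕ n)))
          ≈⟨ +-congˡ (+-cong (trans (sum-cong-≋ middle) (sum-replicate-zero n)) last) ⟩
        y ^ suc n + (0# + x ^ suc n)             ≈⟨ +-congˡ (+-identityˡ _) ⟩
        y ^ suc n + x ^ suc n                    ≈⟨ +-comm _ _ ⟩
        x ^ suc n + y ^ suc n                    ∎
        where
        t = binomialTerm x y (suc n)
        first : t zero ≈ y ^ suc n
        first = begin
          (suc n C 0) · (1# * y ^ suc n)  ≈⟨ ×-cong (≡.trans (nCk≡nC[n∸k] {0} {suc n} ℕ.z≤n) (nCn≡1 (suc n))) (*-identityˡ _) ⟩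
          1 · y ^ suc n                   ≈⟨ +-identityʳ _ ⟩
          y ^ suc n                       ∎
        last : t (suc (fromℕ n)) ≈ x ^ suc n
        last = go-last (Fin.toℕ-fromℕ n)
          where
          go-last : ∀ {m} → m ≡ n → (suc n C suc m) · (x ^ suc m * y ^ (n ℕ.∸ m)) ≈ x ^ suc n
          go-last refl = begin
            (suc n C suc n) · (x ^ suc n * y ^ (n ℕ.∸ n))
              ≈⟨ ×-cong (nCn≡1 (suc n)) (*-congˡ (^-congʳ y (ℕ.n∸n≡0 n))) ⟩
            1 · (x ^ suc n * 1#)  ≈⟨ trans (+-identityʳ _) (*-identityʳ _) ⟩
            x ^ suc n             ∎
        middle : ∀ k → t (suc (inject₁ k)) ≈ 0#
        middle k = interior (s≤s ℕ.z≤n) (s≤s (≡.subst (ℕ._< n) (≡.sym (Fin.toℕ-inject₁ k)) (Fin.toℕ<n k)))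

    frobenius-^-+ : ∀ e x y → (x + y) ^ (p ℕ.^ e) ≈ x ^ (p ℕ.^ e) + y ^ (p ℕ.^ e)
    frobenius-^-+ zero    x y = trans (*-identityʳ _) (sym (+-cong (*-identityʳ _) (*-identityʳ _)))
    frobenius-^-+ (suc e) x y = begin
      (x + y) ^ (p ℕ.* p ℕ.^ e)                        ≈⟨ ^-assocʳ (x + y) p (p ℕ.^ e) ⟨
      ((x + y) ^ p) ^ (p ℕ.^ e)                        ≈⟨ ^-congˡ (p ℕ.^ e) (frobenius-+ x y) ⟩
      (x ^ p + y ^ p) ^ (p ℕ.^ e)                      ≈⟨ frobenius-^-+ e (x ^ p) (y ^ p) ⟩
      (x ^ p) ^ (p ℕ.^ e) + (y ^ p) ^ (p ℕ.^ e)
        ≈⟨ +-cong (^-assocʳ x p (p ℕ.^ e)) (^-assocʳ y p (p ℕ.^ e)) ⟩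
      x ^ (p ℕ.* p ℕ.^ e) + y ^ (p ℕ.* p ℕ.^ e)        ∎

-- Polynomials as coefficient vectors, and the bound on their roots.

module Polynomials {c ℓ} (R : CommutativeRing c ℓ) where

  open CommutativeRing R hiding (zero) renaming (refl to ≈-refl)
  open GroupProperties +-group using (x∙y⁻¹≈ε⇒x≈y; //-rightDividesˡ)
  open SemiringSolver commutativeSemiring using (solve; _:+_; _:*_; _:=_)
  open import Relation.Binary.Reasoning.Setoid setoid

  eval : ∀ {n} → (Fin n → Carrier) → Carrier → Carrier
  eval {zero}  f x = 0#
  eval {suc n} f x = f zero + x * eval (f ∘ suc) x

  -- Synthetic division of f - f(r) by Y - r: coefficient i is the value at r of what remains of `f`
  -- after its first i + 1 coefficients are dropped.
  quotient : ∀ {n} → (Fin (suc n) → Carrier) → Carrier → Fin n → Carrier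
  quotient f r zero    = eval (f ∘ suc) r
  quotient f r (suc i) = quotient (f ∘ suc) r i

  -- The factor theorem at y = r + s, which makes it a semiring identity.
  eval-quotient : ∀ {n} (f : Fin (suc n) → Carrier) r s →
                  eval f (r + s) ≈ eval f r + s * eval (quotient f r) (r + s)
  eval-quotient {zero} f r s = begin
    f zero + (r + s) * 0#     ≈⟨ +-congˡ (trans (zeroʳ _) (sym (zeroʳ _))) ⟩
    f zero + r * 0#           ≈⟨ +-identityʳ _ ⟨
    f zero + r * 0# + 0#      ≈⟨ +-congˡ (zeroʳ s) ⟨
    f zero + r * 0# + s * 0#  ∎
  eval-quotient {suc n} f r s = begin
    f zero + (r + s) * eval (f ∘ suc) (r + s)
      ≈⟨ +-congˡ (*-congˡ (eval-quotient (f ∘ suc) r s)) ⟩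
    f zero + (r + s) * (eval (f ∘ suc) r + s * eval (quotient (f ∘ suc) r) (r + s))
      ≈⟨ rearrange (f zero) r s (eval (f ∘ suc) r) (eval (quotient (f ∘ suc) r) (r + s)) ⟩
    f zero + r * eval (f ∘ suc) r + s * (eval (f ∘ suc) r + (r + s) * eval (quotient (f ∘ suc) r) (r + s))
      ∎
    where
    rearrange : ∀ a r s h g →
                a + (r + s) * (h + s * g) ≈ a + r * h + s * (h + (r + s) * g)
    rearrange = solve 5 (λ a r s h g → a :+ (r :+ s) :* (h :+ s :* g) :=
                                       a :+ r :* h :+ s :* (h :+ (r :+ s) :* g)) ≈-refl

  quotient-zero : ∀ {n} (f : Fin (suc n) → Carrier) r → eval f r ≈ 0# →
                  (∀ i → quotient f r i ≈ 0#) → ∀ i → f i ≈ 0#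
  quotient-zero {n} f r fr≈0 g≈0 zero = begin
    f zero                         ≈⟨ +-identityʳ _ ⟨
    f zero + 0#                    ≈⟨ +-congˡ (trans (*-congˡ (tail≈0 f g≈0)) (zeroʳ r)) ⟨
    f zero + r * eval (f ∘ suc) r  ≈⟨ fr≈0 ⟩
    0#                             ∎
    where
    tail≈0 : ∀ {n} (f : Fin (suc n) → Carrier) → (∀ i → quotient f r i ≈ 0#) → eval (f ∘ suc) r ≈ 0#
    tail≈0 {zero}  f g≈0 = ≈-refl
    tail≈0 {suc n} f g≈0 = g≈0 zero
  quotient-zero {suc n} f r fr≈0 g≈0 (suc i) =
    quotient-zero (f ∘ suc) r (g≈0 zero) (g≈0 ∘ suc) i

  module _ (integral : ∀ {x y} → x * y ≈ 0# → x ≈ 0# ⊎ y ≈ 0#) where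

    -- The other roots differ from r₀, so by integrality they are roots of the quotient by Y - r₀,
    -- which has one coefficient fewer. If the quotient has zero coefficients, so has `f`.
    roots⇒zero : ∀ {n} (f : Fin n → Carrier) (r : Fin n → Carrier) →
                 (∀ {i j} → r i ≈ r j → i ≡ j) → (∀ i → eval f (r i) ≈ 0#) → ∀ i → f i ≈ 0#
    roots⇒zero {suc n} f r r-injective fr≈0 =
      quotient-zero f r₀ (fr≈0 zero)
        (roots⇒zero (quotient f r₀) (r ∘ suc) (Fin.suc-injective ∘ r-injective) root)
      where
      r₀ = r zero
      root : ∀ i → eval (quotient f r₀) (r (suc i)) ≈ 0#
      root i with integral product≈0
        where
        y = r (suc i)
        y≈ : r₀ + (y - r₀) ≈ y
        y≈ = trans (+-comm _ _) (//-rightDividesˡ r₀ y)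
        eval-congʳ : ∀ {n} (h : Fin n → Carrier) {x y} → x ≈ y → eval h x ≈ eval h y
        eval-congʳ {zero}  h x≈y = ≈-refl
        eval-congʳ {suc n} h x≈y = +-congˡ (*-cong x≈y (eval-congʳ (h ∘ suc) x≈y))
        product≈0 : (y - r₀) * eval (quotient f r₀) y ≈ 0#
        product≈0 = begin
          (y - r₀) * eval (quotient f r₀) y                              ≈⟨ *-congˡ (eval-congʳ (quotient f r₀) y≈) ⟨
          (y - r₀) * eval (quotient f r₀) (r₀ + (y - r₀))                ≈⟨ +-identityˡ _ ⟨
          0# + (y - r₀) * eval (quotient f r₀) (r₀ + (y - r₀))           ≈⟨ +-congʳ (fr≈0 zero) ⟨
          eval f r₀ + (y - r₀) * eval (quotient f r₀) (r₀ + (y - r₀))    ≈⟨ eval-quotient f r₀ (y - r₀) ⟨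
          eval f (r₀ + (y - r₀))                                         ≈⟨ eval-congʳ f y≈ ⟩
          eval f y                                                       ≈⟨ fr≈0 (suc i) ⟩
          0#                                                             ∎
      ... | inj₁ y-r₀≈0 = contradiction (r-injective (x∙y⁻¹≈ε⇒x≈y _ _ y-r₀≈0)) λ ()
      ... | inj₂ gy≈0   = gy≈0

-- The subring fixed by a power of Frobenius.

module _ {c ℓ} (R : CommutativeRing c ℓ) where

  open CommutativeRing R hiding (zero) renaming (refl to ≈-refl)

  module FixedByFrobenius {p} (prime-p : Prime p) (p×1≈0 : Mult._×_ semiring p 1# ≈ 0#) where

    open Exp commutativeSemiring
    open Mult semiring hiding (_×_)
    open Mult semiring using () renaming (_×_ to _·_)
    open PrimeCharacteristic R prime-p p×1≈0
    open GroupProperties +-group using (inverseˡ-unique; identityʳ-unique)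
    open import Relation.Binary.Reasoning.Setoid setoid

    -- Closure under the ring operations serves twice: to extend X^q = X to every polynomial in X,
    -- and to see that prime field elements are fixed by all powers of Frobenius.
    Fixed : ℕ → Carrier → Set ℓ
    Fixed e x = x ^ (p ℕ.^ e) ≈ x

    module _ (e : ℕ) where

      fixed-+ : ∀ {x y} → Fixed e x → Fixed e y → Fixed e (x + y)
      fixed-+ {x} {y} fx fy = trans (frobenius-^-+ e x y) (+-cong fx fy)

      -- Additivity at 0 + 0 gives this without any appeal to the exponent being nonzero.
      fixed-0 : Fixed e 0#
      fixed-0 = identityʳ-unique _ _ (trans (sym (frobenius-^-+ e 0# 0#)) (^-congˡ (p ℕ.^ e) (+-identityˡ 0#)))

      fixed-neg : ∀ {x} → Fixed e x → Fixed e (- x)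
      fixed-neg {x} fx = inverseˡ-unique _ _ (begin
        (- x) ^ (p ℕ.^ e) + x                ≈⟨ +-congˡ fx ⟨
        (- x) ^ (p ℕ.^ e) + x ^ (p ℕ.^ e)    ≈⟨ frobenius-^-+ e (- x) x ⟨
        (- x + x) ^ (p ℕ.^ e)                ≈⟨ ^-congˡ (p ℕ.^ e) (-‿inverseˡ x) ⟩
        0# ^ (p ℕ.^ e)                       ≈⟨ fixed-0 ⟩
        0#                                   ∎)

      fixed-* : ∀ {x y} → Fixed e x → Fixed e y → Fixed e (x * y)
      fixed-* {x} {y} fx fy = trans (^-distrib-* x y (p ℕ.^ e)) (*-cong fx fy)

      fixed-1 : Fixed e 1#
      fixed-1 = 1^ (p ℕ.^ e)
        where
        1^ : ∀ n → 1# ^ n ≈ 1#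
        1^ zero    = ≈-refl
        1^ (suc n) = trans (*-identityˡ _) (1^ n)

      fixed-× : ∀ n → Fixed e (n · 1#)
      fixed-× zero    = fixed-0
      fixed-× (suc n) = fixed-+ fixed-1 (fixed-× n)

    -- Powers of Frobenius fix the coefficients and are additive and multiplicative, so they carry
    -- roots of `f` to roots of `f`.
    ^-eval : ∀ e {n} (f : Fin n → Carrier) → (∀ i → Fixed e (f i)) → ∀ x →
             Polynomials.eval R f x ^ (p ℕ.^ e) ≈ Polynomials.eval R f (x ^ (p ℕ.^ e))
    ^-eval e {zero}  f fixed x = fixed-0 e
    ^-eval e {suc n} f fixed x = begin
      (f zero + x * eval (f ∘ suc) x) ^ (p ℕ.^ e)
        ≈⟨ frobenius-^-+ e _ _ ⟩
      f zero ^ (p ℕ.^ e) + (x * eval (f ∘ suc) x) ^ (p ℕ.^ e)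
        ≈⟨ +-cong (fixed zero) (^-distrib-* x _ (p ℕ.^ e)) ⟩
      f zero + x ^ (p ℕ.^ e) * eval (f ∘ suc) x ^ (p ℕ.^ e)
        ≈⟨ +-congˡ (*-congˡ (^-eval e (f ∘ suc) (fixed ∘ suc) x)) ⟩
      f zero + x ^ (p ℕ.^ e) * eval (f ∘ suc) (x ^ (p ℕ.^ e))
        ∎
      where open Polynomials R using (eval)

    ^-p^+ : ∀ x a b → (x ^ (p ℕ.^ a)) ^ (p ℕ.^ b) ≈ x ^ (p ℕ.^ (a ℕ.+ b))
    ^-p^+ x a b = trans (^-assocʳ x (p ℕ.^ a) (p ℕ.^ b)) (^-congʳ x (≡.sym (ℕ.^-distribˡ-+-* p a b)))

-- Counting the elements of the field.

module _ {c ℓ} (R : CommutativeRing c ℓ) where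

  open CommutativeRing R hiding (zero) renaming (refl to ≈-refl)
  open Exp commutativeSemiring using (_^_)

  -- The d conjugates of θ make 1, θ, …, θ^(d-1) independent over 𝔽_p, which gives q = p^d
  -- elements; they are all roots of Y^q - Y, which leaves no room for another one.
  module FieldOfOrder {p d r} (prime-p : Prime p) (p^d≡2+r : p ℕ.^ d ≡ 2 ℕ.+ r)
    (p×1≈0 : Mult._×_ semiring p 1# ≈ 0#)
    (1≉0 : ¬ 1# ≈ 0#)
    (zero-or-root-of-unity : ∀ x → x ≈ 0# ⊎ x ^ suc r ≈ 1#)
    (θ : Carrier) (θ-conjugates : ∀ e → 0 ℕ.< e → e ℕ.< d → ¬ (θ ^ (p ℕ.^ e) ≈ θ))
    where

    open Exp commutativeSemiring hiding (_^_)
    open Mult semiring using (×-homo-+; ×-assocˡ; ×-congˡ; ×-congʳ) renaming (_×_ to _·_)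
    open PrimeCharacteristic R prime-p p×1≈0
    open FixedByFrobenius R prime-p p×1≈0
    open GroupProperties +-group using (x∙y⁻¹≈ε⇒x≈y; x≈y⇒x∙y⁻¹≈ε; identityʳ-unique)
    open AbelianGroupProperties +-abelianGroup using (⁻¹-∙-comm)
    open RingProperties ring using (-‿distribʳ-*)
    open Polynomials R
    open import Relation.Binary.Reasoning.Setoid setoid

    -- A nonzero `x` has the inverse `x ^ r`.
    integral : ∀ {x y} → x * y ≈ 0# → x ≈ 0# ⊎ y ≈ 0#
    integral {x} {y} xy≈0 with zero-or-root-of-unity x
    ... | inj₁ x≈0  = inj₁ x≈0
    ... | inj₂ xʳ≈1 = inj₂ (begin
      y                  ≈⟨ *-identityˡ y ⟨
      1# * y             ≈⟨ *-congʳ xʳ≈1 ⟨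
      x * x ^ r * y      ≈⟨ *-congʳ (*-comm x _) ⟩
      x ^ r * x * y      ≈⟨ *-assoc _ _ _ ⟩
      x ^ r * (x * y)    ≈⟨ *-congˡ xy≈0 ⟩
      x ^ r * 0#         ≈⟨ zeroʳ _ ⟩
      0#                 ∎)

    _≟_ : ∀ x y → Dec (x ≈ y)
    x ≟ y with zero-or-root-of-unity (x - y)
    ... | inj₁ x-y≈0 = yes (x∙y⁻¹≈ε⇒x≈y x y x-y≈0)
    ... | inj₂ root  = no λ x≈y → 1≉0 (begin
      1#                    ≈⟨ root ⟨
      (x - y) ^ suc r       ≈⟨ *-congʳ (x≈y⇒x∙y⁻¹≈ε x≈y) ⟩
      0# * (x - y) ^ r      ≈⟨ zeroˡ _ ⟩
      0#                    ∎)

    x^q≈x : ∀ x → x ^ (p ℕ.^ d) ≈ x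
    x^q≈x x rewrite p^d≡2+r with zero-or-root-of-unity x
    ... | inj₁ x≈0  = trans (*-congʳ x≈0) (trans (zeroˡ _) (sym x≈0))
    ... | inj₂ xʳ≈1 = trans (*-congˡ xʳ≈1) (*-identityʳ x)

    bezout : ∀ a b {m n} → m · 1# ≈ 0# → n · 1# ≈ 0# → 1 ℕ.+ a ℕ.* m ≡ b ℕ.* n → 1# ≈ 0#
    bezout a b {m} {n} m≈0 n≈0 eq = begin
      1#                    ≈⟨ +-identityʳ 1# ⟨
      1# + 0#               ≈⟨ +-congˡ (trans (×-congʳ a m≈0) (n×0≈0 a)) ⟨
      1# + a · (m · 1#)     ≈⟨ +-congˡ (×-assocˡ 1# a m) ⟩
      (1 ℕ.+ a ℕ.* m) · 1#  ≈⟨ ×-congˡ eq ⟩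
      (b ℕ.* n) · 1#        ≈⟨ ×-assocˡ 1# b n ⟨
      b · (n · 1#)          ≈⟨ trans (×-congʳ b n≈0) (n×0≈0 b) ⟩
      0#                    ∎

    -- Since n and p are coprime, Bézout writes 1 as a combination of n · 1 and p · 1, which would
    -- both vanish.
    n×1≉0 : ∀ {n} → .{{_ : NonZero n}} → n ℕ.< p → ¬ (n · 1# ≈ 0#)
    n×1≉0 {n} n<p n×1≈0 with coprime-Bézout (prime⇒coprime prime-p n<p)
    ... | Bézout.+- x y eq = 1≉0 (bezout y x n×1≈0 p×1≈0 eq)
    ... | Bézout.-+ x y eq = 1≉0 (bezout x y p×1≈0 n×1≈0 eq)

    <⇒×1≉ : ∀ {m n} → m ℕ.< n → n ℕ.< p → ¬ (m · 1# ≈ n · 1#)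
    <⇒×1≉ {m} {n} m<n n<p m×1≈n×1 =
      n×1≉0 {{ℕ.>-nonZero (ℕ.m<n⇒0<n∸m m<n)}} (ℕ.≤-<-trans (ℕ.m∸n≤m n m) n<p)
        (identityʳ-unique (m · 1#) _ (begin
          m · 1# + (n ℕ.∸ m) · 1#   ≈⟨ ×-homo-+ 1# m (n ℕ.∸ m) ⟨
          (m ℕ.+ (n ℕ.∸ m)) · 1#    ≈⟨ ×-congˡ (ℕ.m+[n∸m]≡n (ℕ.<⇒≤ m<n)) ⟩
          n · 1#                    ≈⟨ m×1≈n×1 ⟨
          m · 1#                    ∎))

    ×1-injective : ∀ (i j : Fin p) → toℕ i · 1# ≈ toℕ j · 1# → i ≡ j
    ×1-injective i j eq with ℕ.<-cmp (toℕ i) (toℕ j)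
    ... | tri< i<j _ _ = contradiction eq (<⇒×1≉ i<j (Fin.toℕ<n j))
    ... | tri≈ _ i≡j _ = Fin.toℕ-injective i≡j
    ... | tri> _ _ j<i = contradiction (sym eq) (<⇒×1≉ j<i (Fin.toℕ<n i))

    conjugate : Fin d → Carrier
    conjugate e = θ ^ (p ℕ.^ toℕ e)

    -- Raising to the power p^(d - b) turns the right side into θ^q = θ and the left side into a
    -- conjugate with exponent a + d - b, which lies strictly between 0 and d.
    conjugate-≉ : ∀ {a b : Fin d} → toℕ a ℕ.< toℕ b → ¬ (conjugate a ≈ conjugate b)
    conjugate-≉ {a} {b} a<b eq = θ-conjugates (toℕ a ℕ.+ k)
      (ℕ.<-≤-trans (ℕ.m<n⇒0<n∸m (Fin.toℕ<n b)) (ℕ.m≤n+m k (toℕ a)))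
      (ℕ.<-≤-trans (ℕ.+-monoˡ-< k a<b) (ℕ.≤-reflexive b+k≡d))
      (begin
        θ ^ (p ℕ.^ (toℕ a ℕ.+ k))    ≈⟨ ^-p^+ θ (toℕ a) k ⟨
        conjugate a ^ (p ℕ.^ k)      ≈⟨ ^-congˡ (p ℕ.^ k) eq ⟩
        conjugate b ^ (p ℕ.^ k)      ≈⟨ ^-p^+ θ (toℕ b) k ⟩
        θ ^ (p ℕ.^ (toℕ b ℕ.+ k))    ≈⟨ ^-congʳ θ (≡.cong (p ℕ.^_) b+k≡d) ⟩
        θ ^ (p ℕ.^ d)                ≈⟨ x^q≈x θ ⟩
        θ                            ∎)
      where
      k = d ℕ.∸ toℕ b
      b+k≡d : toℕ b ℕ.+ k ≡ d
      b+k≡d = ℕ.m+[n∸m]≡n (ℕ.<⇒≤ (Fin.toℕ<n b))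

    conjugate-injective : ∀ {a b} → conjugate a ≈ conjugate b → a ≡ b
    conjugate-injective {a} {b} eq with ℕ.<-cmp (toℕ a) (toℕ b)
    ... | tri< a<b _ _ = contradiction eq (conjugate-≉ a<b)
    ... | tri≈ _ a≡b _ = Fin.toℕ-injective a≡b
    ... | tri> _ _ b<a = contradiction (sym eq) (conjugate-≉ b<a)

    eval-minus : ∀ {n} (f g : Fin n → Carrier) x → eval (λ i → f i - g i) x ≈ eval f x - eval g x
    eval-minus {zero}  f g x = sym (-‿inverseʳ 0#)
    eval-minus {suc n} f g x = begin
      (f zero - g zero) + x * eval (λ i → f (suc i) - g (suc i)) x  ≈⟨ +-congˡ (*-congˡ (eval-minus (f ∘ suc) (g ∘ suc) x)) ⟩
      (f zero - g zero) + x * (F - G)                    ≈⟨ +-congˡ (distribˡ x F (- G)) ⟩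
      (f zero - g zero) + (x * F + x * - G)              ≈⟨ +-congˡ (+-congˡ (-‿distribʳ-* x G)) ⟨
      (f zero - g zero) + (x * F - x * G)                ≈⟨ interchange _ _ _ _ ⟩
      (f zero + x * F) + (- g zero - x * G)              ≈⟨ +-congˡ (⁻¹-∙-comm _ _) ⟩
      (f zero + x * F) - (g zero + x * G)                ∎
      where
      F = eval (f ∘ suc) x
      G = eval (g ∘ suc) x
      open CommutativeSemigroupProperties +-commutativeSemigroup using (interchange)

    -- The base-p digits of the index, read in the prime field.
    coefficients : Fin (p ℕ.^ d) → Fin d → Carrier
    coefficients k i = toℕ (finToFun {p} {d} k i) · 1#

    element : Fin (p ℕ.^ d) → Carrier
    element k = eval (coefficients k) θ

    -- The difference of the two digit polynomials has d coefficients in the prime field. It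
    -- vanishes at θ, hence at all d conjugates, so it is zero, and distinct digits stay distinct in
    -- the field.
    element-injective : ∀ {k l} → element k ≈ element l → k ≡ l
    element-injective {k} {l} eq =
      ≡.trans (≡.sym (Fin.funToFin-finToFin {d} {p} k))
        (≡.trans (funToFin-cong same-digits) (Fin.funToFin-finToFin {d} {p} l))
      where
      f : Fin d → Carrier
      f i = coefficients k i - coefficients l i
      f-root : eval f θ ≈ 0#
      f-root = trans (eval-minus (coefficients k) (coefficients l) θ) (x≈y⇒x∙y⁻¹≈ε eq)
      fixed-f : ∀ e i → Fixed e (f i)
      fixed-f e i = fixed-+ e (fixed-× e (toℕ (finToFun {p} {d} k i)))
        (fixed-neg e (fixed-× e (toℕ (finToFun {p} {d} l i))))
      f-conjugate : ∀ e → eval f (conjugate e) ≈ 0#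
      f-conjugate e = begin
        eval f (conjugate e)          ≈⟨ ^-eval (toℕ e) f (fixed-f (toℕ e)) θ ⟨
        eval f θ ^ (p ℕ.^ toℕ e)      ≈⟨ ^-congˡ (p ℕ.^ toℕ e) f-root ⟩
        0# ^ (p ℕ.^ toℕ e)            ≈⟨ fixed-0 (toℕ e) ⟩
        0#                            ∎
      same-digits : ∀ i → finToFun {p} {d} k i ≡ finToFun {p} {d} l i
      same-digits i = ×1-injective _ _
        (x∙y⁻¹≈ε⇒x≈y _ _ (roots⇒zero integral f conjugate conjugate-injective f-conjugate i))
      funToFin-cong : ∀ {m n} {f g : Fin m → Fin n} → (∀ i → f i ≡ g i) → funToFin f ≡ funToFin g
      funToFin-cong {zero}  f≗g = refl
      funToFin-cong {suc m} f≗g = ≡.cong₂ Fin.combine (f≗g zero) (funToFin-cong (f≗g ∘ suc))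

    monomial : ∀ n → Fin (suc n) → Carrier
    monomial zero    _       = 1#
    monomial (suc n) zero    = 0#
    monomial (suc n) (suc i) = monomial n i

    eval-monomial : ∀ n x → eval (monomial n) x ≈ x ^ n
    eval-monomial zero    x = trans (+-congˡ (zeroʳ x)) (+-identityʳ 1#)
    eval-monomial (suc n) x = trans (+-identityˡ _) (*-congˡ (eval-monomial n x))

    monomial-lead : ∀ n → monomial n (fromℕ n) ≡ 1#
    monomial-lead zero    = refl
    monomial-lead (suc n) = monomial-lead n

    Y^q-Y : Fin (3 ℕ.+ r) → Carrier
    Y^q-Y zero          = 0#
    Y^q-Y (suc zero)    = - 1#
    Y^q-Y (suc (suc i)) = monomial r i

    eval-Y^q-Y : ∀ x → eval Y^q-Y x ≈ 0#
    eval-Y^q-Y x = begin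
      0# + x * (- 1# + x * eval (monomial r) x)   ≈⟨ +-identityˡ _ ⟩
      x * (- 1# + x * eval (monomial r) x)        ≈⟨ *-congˡ (+-congˡ (*-congˡ (eval-monomial r x))) ⟩
      x * (- 1# + x ^ suc r)                      ≈⟨ vanish (zero-or-root-of-unity x) ⟩
      0#                                          ∎
      where
      vanish : x ≈ 0# ⊎ x ^ suc r ≈ 1# → x * (- 1# + x ^ suc r) ≈ 0#
      vanish (inj₁ x≈0)  = trans (*-congʳ x≈0) (zeroˡ _)
      vanish (inj₂ xʳ≈1) = trans (*-congˡ (trans (+-congˡ xʳ≈1) (-‿inverseˡ 1#))) (zeroʳ x)

    element-surjective : ∀ y → ∃ λ k → element k ≈ y
    element-surjective y with Fin.any? (λ k → element k ≟ y)
    ... | yes found = found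
    ... | no missed = contradiction
      (≡.subst (_≈ 0#) (monomial-lead r)
        -- The index picks the leading coefficient of Y^q - Y, which is 1; the missed `y` and the q
        -- listed elements are q + 1 roots.
        (roots⇒zero integral Y^q-Y points points-injective (λ i → eval-Y^q-Y (points i)) (suc (suc (fromℕ r)))))
      1≉0
      where
      index : Fin (2 ℕ.+ r) → Fin (p ℕ.^ d)
      index = Fin.cast (≡.sym p^d≡2+r)
      points : Fin (3 ℕ.+ r) → Carrier
      points zero    = y
      points (suc i) = element (index i)
      points-injective : ∀ {i j} → points i ≈ points j → i ≡ j
      points-injective {zero}  {zero}  _  = refl
      points-injective {zero}  {suc j} eq = contradiction (index j , sym eq) missed
      points-injective {suc i} {zero}  eq = contradiction (index i , eq) missed
      points-injective {suc i} {suc j} eq = ≡.cong suc (Fin.toℕ-injective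
        (≡.trans (≡.sym (Fin.toℕ-cast (≡.sym p^d≡2+r) i))
          (≡.trans (≡.cong toℕ (element-injective {index i} {index j} eq)) (Fin.toℕ-cast (≡.sym p^d≡2+r) j))))

    enumeration : Inverse (≡.setoid (Fin (p ℕ.^ d))) setoid
    enumeration = record
      { to        = element
      ; from      = λ y → proj₁ (element-surjective y)
      ; to-cong   = λ { refl → ≈-refl }
      ; from-cong = λ {x} {y} x≈y → element-injective
          (trans (proj₂ (element-surjective x)) (trans x≈y (sym (proj₂ (element-surjective y)))))
      ; inverse   = (λ { {x} refl → proj₂ (element-surjective x) })
                  , (λ {x} {y} y≈ → element-injective (trans (proj₂ (element-surjective y)) y≈))
      }

-- Polynomial terms acting on an abelian group.

data Term : Set where
  O I X   : Term
  _⊞_ _⊠_ : Term → Term → Term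
  ⊟_      : Term → Term

-- The power `_^_` belongs to the ring of one particular `s`; this term is the same for all `s`,
-- which matters while `s` is being replaced.
pow : Term → ℕ → Term
pow a zero    = I
pow a (suc n) = a ⊠ pow a n

module _ (V : AbelianGroup 0ℓ 0ℓ) where

  open AbelianGroup V renaming (refl to ≈-refl)

  -- Terms stand for elements of ℤ[X], with X acting as σ. Comparing them by their action
  -- on s makes cyclic s the quotient of ℤ[X] by the annihilator of s.
  module CyclicModule (σ : Carrier → Carrier)
    (σ-cong : ∀ {s t} → s ≈ t → σ s ≈ σ t)
    (σ-∙ : ∀ s t → σ (s ∙ t) ≈ σ s ∙ σ t)
    where

    open AbelianGroupProperties V using (⁻¹-∙-comm; inverseˡ-unique; identityʳ-unique)
    open CommutativeSemigroupProperties commutativeSemigroup using (interchange)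
    open import Relation.Binary.Reasoning.Setoid setoid

    act : Term → Carrier → Carrier
    act O       s = ε
    act I       s = s
    act X       s = σ s
    act (a ⊞ b) s = act a s ∙ act b s
    act (a ⊠ b) s = act a (act b s)
    act (⊟ a)   s = act a s ⁻¹

    σ-ε : σ ε ≈ ε
    σ-ε = identityʳ-unique (σ ε) (σ ε) (trans (sym (σ-∙ ε ε)) (σ-cong (identityˡ ε)))

    σ-⁻¹ : ∀ s → σ (s ⁻¹) ≈ σ s ⁻¹
    σ-⁻¹ s = inverseˡ-unique _ _ (trans (sym (σ-∙ (s ⁻¹) s)) (trans (σ-cong (inverseˡ s)) σ-ε))

    act-cong : ∀ a {s t} → s ≈ t → act a s ≈ act a t
    act-cong O       s≈t = ≈-refl
    act-cong I       s≈t = s≈t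
    act-cong X       s≈t = σ-cong s≈t
    act-cong (a ⊞ b) s≈t = ∙-cong (act-cong a s≈t) (act-cong b s≈t)
    act-cong (a ⊠ b) s≈t = act-cong a (act-cong b s≈t)
    act-cong (⊟ a)   s≈t = ⁻¹-cong (act-cong a s≈t)

    act-∙ : ∀ a s t → act a (s ∙ t) ≈ act a s ∙ act a t
    act-∙ O       s t = sym (identityˡ ε)
    act-∙ I       s t = ≈-refl
    act-∙ X       s t = σ-∙ s t
    act-∙ (a ⊞ b) s t = trans (∙-cong (act-∙ a s t) (act-∙ b s t)) (interchange _ _ _ _)
    act-∙ (a ⊠ b) s t = trans (act-cong a (act-∙ b s t)) (act-∙ a _ _)
    act-∙ (⊟ a)   s t = trans (⁻¹-cong (act-∙ a s t)) (sym (⁻¹-∙-comm _ _))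

    act-ε : ∀ a → act a ε ≈ ε
    act-ε a = identityʳ-unique (act a ε) (act a ε) (trans (sym (act-∙ a ε ε)) (act-cong a (identityˡ ε)))

    act-⁻¹ : ∀ a s → act a (s ⁻¹) ≈ act a s ⁻¹
    act-⁻¹ a s = inverseˡ-unique _ _ (trans (sym (act-∙ a (s ⁻¹) s)) (trans (act-cong a (inverseˡ s)) (act-ε a)))

    act-σ : ∀ a s → act a (σ s) ≈ σ (act a s)
    act-σ O       s = sym σ-ε
    act-σ I       s = ≈-refl
    act-σ X       s = ≈-refl
    act-σ (a ⊞ b) s = trans (∙-cong (act-σ a s) (act-σ b s)) (sym (σ-∙ _ _))
    act-σ (a ⊠ b) s = trans (act-cong a (act-σ b s)) (act-σ a (act b s))
    act-σ (⊟ a)   s = trans (⁻¹-cong (act-σ a s)) (sym (σ-⁻¹ _))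

    -- All terms are built from the single operator σ, so everything reduces to `act-σ`.
    act-comm : ∀ a b s → act a (act b s) ≈ act b (act a s)
    act-comm O        b s = sym (act-ε b)
    act-comm I        b s = ≈-refl
    act-comm X        b s = sym (act-σ b s)
    act-comm (a ⊞ a′) b s = trans (∙-cong (act-comm a b s) (act-comm a′ b s)) (sym (act-∙ b _ _))
    act-comm (a ⊠ a′) b s = trans (act-cong a (act-comm a′ b s)) (act-comm a b (act a′ s))
    act-comm (⊟ a)    b s = trans (⁻¹-cong (act-comm a b s)) (sym (act-⁻¹ b _))

    cyclic : Carrier → CommutativeRing 0ℓ 0ℓ
    cyclic s = record
      { Carrier = Term
      ; _≈_ = λ a b → act a s ≈ act b s
      ; _+_ = _⊞_ ; _*_ = _⊠_ ; -_ = ⊟_ ; 0# = O ; 1# = I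
      ; isCommutativeRing = record
        { isRing = record
          { +-isAbelianGroup = record
            { isGroup = record
              { isMonoid = record
                { isSemigroup = record
                  { isMagma = record
                    { isEquivalence = record { refl = ≈-refl ; sym = sym ; trans = trans }
                    ; ∙-cong = ∙-cong
                    }
                  ; assoc = λ _ _ _ → assoc _ _ _
                  }
                ; identity = (λ _ → identityˡ _) , (λ _ → identityʳ _)
                }
              ; inverse = (λ _ → inverseˡ _) , (λ _ → inverseʳ _)
              ; ⁻¹-cong = ⁻¹-cong
              }
            ; comm = λ _ _ → comm _ _
            }
          -- `a` and `a′` are known to agree only at `s`, so commutativity first brings them next to
          -- `s`.
          ; *-cong = λ {a} {a′} {b} {b′} a≈a′ b≈b′ → begin
              act a (act b s)    ≈⟨ act-cong a b≈b′ ⟩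
              act a (act b′ s)   ≈⟨ act-comm a b′ s ⟩
              act b′ (act a s)   ≈⟨ act-cong b′ a≈a′ ⟩
              act b′ (act a′ s)  ≈⟨ act-comm b′ a′ s ⟩
              act a′ (act b′ s)  ∎
          ; *-assoc = λ _ _ _ → ≈-refl
          ; *-identity = (λ _ → ≈-refl) , (λ _ → ≈-refl)
          ; distrib = (λ a _ _ → act-∙ a _ _) , (λ _ _ _ → ≈-refl)
          }
        ; *-comm = λ a b → act-comm a b s
        }
      }

    module _ {s : Carrier} where
      open CommutativeRing (cyclic s) using (commutativeSemiring) renaming (_≈_ to _≈ˢ_)
      open Exp commutativeSemiring using (_^_; ^-congˡ)

      pow≡^ : ∀ a n → pow a n ≡ a ^ n
      pow≡^ a zero    = refl
      pow≡^ a (suc n) = ≡.cong (a ⊠_) (pow≡^ a n)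

      pow-cong : ∀ {a b} n → a ≈ˢ b → pow a n ≈ˢ pow b n
      pow-cong {a} {b} n a≈b rewrite pow≡^ a n | pow≡^ b n = ^-congˡ n a≈b

    module _ (N : ℕ) where

      Settled : Term → Carrier → Set
      Settled a s = act a s ≈ ε ⊎ act (pow a N) s ≈ s

      -- Both alternatives are equations between actions on `s`; applying `b` preserves them, as it
      -- commutes with every action.
      Settled-act : ∀ a b {s} → Settled a s → Settled a (act b s)
      Settled-act a b {s} (inj₁ as≈0) = inj₁ (trans (act-comm a b s) (trans (act-cong b as≈0) (act-ε b)))
      Settled-act a b {s} (inj₂ aᴺs≈s) = inj₂ (trans (act-comm (pow a N) b s) (act-cong b aᴺs≈s))

      Settled-cong : ∀ {a b s} → act a s ≈ act b s → Settled a s → Settled b s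
      Settled-cong a≈b (inj₁ as≈0)  = inj₁ (trans (sym a≈b) as≈0)
      Settled-cong {a} {b} {s} a≈b (inj₂ aᴺs≈s) = inj₂ (trans (sym (pow-cong {s} {a} {b} N a≈b)) aᴺs≈s)

      Settled-self : ∀ a {s} → act (pow a (suc N)) s ≈ act a s → act (pow a N) (act a s) ≈ act a s
      Settled-self a {s} fixed = trans (act-comm (pow a N) a s) fixed

      -- If a^(N+1) = a on s, then a^N fixes act a s. Hence replacing s by act a s whenever
      -- that is nonzero settles a, and what has been settled before stays settled.
      settle : (s : Carrier) → (∀ b → Dec (act b s ≈ ε)) → (∀ a → act (pow a (suc N)) s ≈ act a s) →
               ¬ (s ≈ ε) → ∀ {n} (f : Fin n → Term) →
               ∃ λ b → ¬ (act b s ≈ ε) × (∀ i → Settled (f i) (act b s))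
      settle s dec fixed s≉0 {zero}  f = I , s≉0 , λ ()
      settle s dec fixed s≉0 {suc n} f with settle s dec fixed s≉0 (f ∘ suc)
      ... | b , bs≉0 , settled with dec (f zero ⊠ b)
      ...   | yes abs≈0 = b , bs≉0 , λ where
        zero    → inj₁ abs≈0
        (suc i) → settled i
      ...   | no  abs≉0 = f zero ⊠ b , abs≉0 , λ where
        zero    → inj₂ (Settled-self (f zero) (begin
          act (pow (f zero) (suc N)) (act b s)  ≈⟨ act-comm (pow (f zero) (suc N)) b s ⟩
          act b (act (pow (f zero) (suc N)) s)  ≈⟨ act-cong b (fixed (f zero)) ⟩
          act b (act (f zero) s)                ≈⟨ act-comm b (f zero) s ⟩
          act (f zero) (act b s)                ∎))
        (suc i) → Settled-act (f (suc i)) (f zero) (settled i)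

-- Integer sequences modulo p under the shift.

-- Being a record, it lets unification recover `x` and `y` from the type of a proof, which bare
-- divisibility of the difference would not.
record _≡_[mod_] (x y : ℤ) (p : ℕ) : Set where
  constructor congruent
  field difference : + p ℤ∣.∣ x ℤ.- y

ℤ-mod : ℕ → AbelianGroup 0ℓ 0ℓ
ℤ-mod p = record
  { Carrier = ℤ
  ; _≈_ = _≈_
  ; _∙_ = ℤ._+_ ; ε = 0ℤ ; _⁻¹ = ℤ.-_
  ; isAbelianGroup = record
    { isGroup = record
      { isMonoid = record
        { isSemigroup = record
          { isMagma = record
            { isEquivalence = record
              { refl  = reflexive refl
              ; sym   = λ {x} {y} (congruent x≈y) → along (flip x y) (ℤ∣.∣m⇒∣-m x≈y)
              ; trans = λ {x} {y} {z} (congruent x≈y) (congruent y≈z) → along (telescope x y z) (ℤ∣.∣m∣n⇒∣m+n x≈y y≈z)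
              }
            ; ∙-cong = λ {x} {y} {u} {v} (congruent x≈y) (congruent u≈v) → along (add x y u v) (ℤ∣.∣m∣n⇒∣m+n x≈y u≈v)
            }
          ; assoc = λ x y z → reflexive (ℤ.+-assoc x y z)
          }
        ; identity = (reflexive ∘ ℤ.+-identityˡ) , (reflexive ∘ ℤ.+-identityʳ)
        }
      ; inverse = (reflexive ∘ ℤ.+-inverseˡ) , (reflexive ∘ ℤ.+-inverseʳ)
      ; ⁻¹-cong = λ {x} {y} (congruent x≈y) → along (negate x y) (ℤ∣.∣m⇒∣-m x≈y)
      }
    ; comm = λ x y → reflexive (ℤ.+-comm x y)
    }
  }
  where
  _≈_ : ℤ → ℤ → Set
  x ≈ y = x ≡ y [mod p ]
  along : ∀ {x y z} → x ≡ y ℤ.- z → + p ℤ∣.∣ x → y ≈ z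
  along eq p∣x = congruent (≡.subst (+ p ℤ∣.∣_) eq p∣x)
  reflexive : ∀ {x y} → x ≡ y → x ≈ y
  reflexive {x} refl = congruent (ℤ∣.divides 0ℤ (ℤ.+-inverseʳ x))
  flip : ∀ x y → ℤ.- (x ℤ.- y) ≡ y ℤ.- x
  flip = solve-∀
  telescope : ∀ x y z → (x ℤ.- y) ℤ.+ (y ℤ.- z) ≡ x ℤ.- z
  telescope = solve-∀
  add : ∀ x y u v → (x ℤ.- y) ℤ.+ (u ℤ.- v) ≡ (x ℤ.+ u) ℤ.- (y ℤ.+ v)
  add = solve-∀
  negate : ∀ x y → ℤ.- (x ℤ.- y) ≡ ℤ.- x ℤ.- ℤ.- y
  negate = solve-∀

module Sequences (p : ℕ) where

  V : AbelianGroup 0ℓ 0ℓ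
  V = Pointwise.abelianGroup ℕ (ℤ-mod p)

  open AbelianGroup (ℤ-mod p) public using () renaming (_≈_ to _≈ₚ_; refl to ≈ₚ-refl; reflexive to ≈ₚ-reflexive; trans to ≈ₚ-trans)
  open AbelianGroup V public using (_≈_; ε; refl; sym; trans) renaming (Carrier to Sequence)
  open CyclicModule V (_∘ suc) (λ s≈t n → s≈t (suc n)) (λ s t n → ≈ₚ-refl) public

  act-X^ : ∀ m s n → act (pow X m) s n ≡ s (m ℕ.+ n)
  act-X^ zero    s n = ≡.refl
  act-X^ (suc m) s n = ≡.trans (act-X^ m s (suc n)) (≡.cong s (ℕ.+-suc m n))

  numeral : ℕ → Term
  numeral zero    = O
  numeral (suc n) = I ⊞ numeral n

  act-numeral : ∀ c s n → act (numeral c) s n ≡ + c ℤ.* s n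
  act-numeral zero    s n = ≡.sym (ℤ.*-zeroˡ (s n))
  act-numeral (suc c) s n = ≡.trans (≡.cong (ℤ._+_ (s n)) (act-numeral c s n)) (≡.sym (ℤ.suc-* (+ c) (s n)))

  p×I≈O : ∀ s → act (Mult._×_ (CommutativeRing.semiring (cyclic s)) p I) s ≈ ε
  p×I≈O s n = ≡.subst (_≈ₚ 0ℤ) (≡.sym (≡.trans (multiple p) (ℤ.*-comm (+ p) (s n))))
    (congruent (ℤ∣.divides (s n) (ℤ.+-identityʳ _)))
    where
    multiple : ∀ m → act (Mult._×_ (CommutativeRing.semiring (cyclic s)) m I) s n ≡ + m ℤ.* s n
    multiple zero    = ≡.sym (ℤ.*-zeroˡ (s n))
    multiple (suc m) = ≡.trans (≡.cong (ℤ._+_ (s n)) (multiple m)) (≡.sym (ℤ.suc-* (+ m) (s n)))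

  horner : ∀ {n} → (Fin n → ℕ) → Term
  horner {zero}  c = O
  horner {suc n} c = numeral (c zero) ⊞ (X ⊠ horner (c ∘ suc))

  horner-zero : ∀ {n} (c : Fin n → ℕ) s m → (∀ (j : Fin n) → s (toℕ j ℕ.+ m) ≡ 0ℤ) → act (horner c) s m ≡ 0ℤ
  horner-zero {zero}  c s m s≡0 = ≡.refl
  horner-zero {suc n} c s m s≡0 = ≡.cong₂ ℤ._+_
    (≡.trans (act-numeral (c zero) s m) (≡.trans (≡.cong (+ c zero ℤ.*_) (s≡0 zero)) (ℤ.*-zeroʳ (+ c zero))))
    (horner-zero (c ∘ suc) s (suc m) (λ j → ≡.trans (≡.cong s (ℕ.+-suc (toℕ j) m)) (s≡0 (suc j))))

  -- The action at m is the sum of c j * s (j + m), so a window of `s` with a single 1 reads off one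
  -- coefficient.
  horner-select : ∀ {n} (c : Fin n → ℕ) s m k → (∀ j → ¬ j ≡ k → s (toℕ j ℕ.+ m) ≡ 0ℤ) →
                  s (toℕ k ℕ.+ m) ≡ 1ℤ → act (horner c) s m ≡ + c k
  horner-select {suc n} c s m zero s≡0 s≡1 = ≡.trans (≡.cong₂ ℤ._+_
    (≡.trans (act-numeral (c zero) s m) (≡.trans (≡.cong (+ c zero ℤ.*_) s≡1) (ℤ.*-identityʳ (+ c zero))))
    (horner-zero (c ∘ suc) s (suc m) (λ j → ≡.trans (≡.cong s (ℕ.+-suc (toℕ j) m)) (s≡0 (suc j) λ ()))))
    (ℤ.+-identityʳ (+ c zero))
  horner-select {suc n} c s m (suc k) s≡0 s≡1 = ≡.trans (≡.cong₂ ℤ._+_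
    (≡.trans (act-numeral (c zero) s m) (≡.trans (≡.cong (+ c zero ℤ.*_) (s≡0 zero λ ())) (ℤ.*-zeroʳ (+ c zero))))
    (horner-select (c ∘ suc) s (suc m) k
      (λ j j≢k → ≡.trans (≡.cong s (ℕ.+-suc (toℕ j) m)) (s≡0 (suc j) (j≢k ∘ Fin.suc-injective)))
      (≡.trans (≡.cong s (ℕ.+-suc (toℕ k) m)) s≡1)))
    (ℤ.+-identityˡ (+ c (suc k)))

  -- For `act a pulse` and m ≤ r this says that `a`, reduced modulo X^N - 1, is monic of degree r -
  -- m: the entries list the coefficients from the top down.
  Leads : Sequence → ℕ → Set
  Leads s m = (∀ n → n ℕ.< m → s n ≡ 0ℤ) × s m ≡ 1ℤ

  -- For 2 ≤ m the leading term of X^m - X is X^m. Multiplying by it raises the degree by m, which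
  -- lowers the leading position by m.
  binomial-leads : ∀ {m k s} → 2 ℕ.≤ m → Leads s (m ℕ.+ k) → Leads (act (pow X m ⊞ (⊟ X)) s) k
  binomial-leads {m} {k} {s} 2≤m (s≡0 , s≡1) =
    (λ n n<k → ≡.cong₂ ℤ._-_
      (≡.trans (act-X^ m s n) (s≡0 _ (ℕ.+-monoʳ-< m n<k)))
      (s≡0 _ (ℕ.<-trans (ℕ.+-monoʳ-< 1 n<k) (ℕ.+-monoˡ-< k 2≤m)))) ,
    ≡.cong₂ ℤ._-_ (≡.trans (act-X^ m s k) s≡1) (s≡0 _ (ℕ.+-monoˡ-< k 2≤m))

-- The field with q = p^d elements, where d = k + 1 and q = r + 2.

module Construction {p k r} (prime-p : Prime p) (p^d≡2+r : p ℕ.^ suc k ≡ 2 ℕ.+ r) where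

  open Sequences p
  open import Relation.Binary.Reasoning.Setoid (AbelianGroup.setoid V)

  private
    instance
      p≢0 : NonZero p
      p≢0 = prime⇒nonZero prime-p

    2≤p : 2 ℕ.≤ p
    2≤p = ℕ.nonTrivial⇒n>1 p {{prime⇒nonTrivial prime-p}}

    N : ℕ
    N = suc r

  -- The shift acts on this sequence with period N = q - 1, so cyclic pulse is
  -- 𝔽_p[X]/(X^N - 1). The coefficient of X^i in a is read off at N - 1 - i.
  pulse : Sequence
  pulse n = if does (n % N ℕ.≟ r) then 1ℤ else 0ℤ

  pulse≡1 : ∀ n → n % N ≡ r → pulse n ≡ 1ℤ
  pulse≡1 n eq = ≡.cong (if_then 1ℤ else 0ℤ) (dec-true (n % N ℕ.≟ r) eq)

  pulse≡0 : ∀ n → ¬ n % N ≡ r → pulse n ≡ 0ℤ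
  pulse≡0 n neq = ≡.cong (if_then 1ℤ else 0ℤ) (dec-false (n % N ℕ.≟ r) neq)

  pulse-periodic : ∀ n → pulse (N ℕ.+ n) ≡ pulse n
  pulse-periodic n = ≡.cong (λ m → if does (m ℕ.≟ r) then 1ℤ else 0ℤ)
    (≡.trans (≡.cong (_% N) (ℕ.+-comm N n)) ([m+n]%n≡m%n n N))

  pulse-leads : Leads pulse r
  pulse-leads = (λ n n<r → pulse≡0 n (λ eq → ℕ.<⇒≢ n<r (≡.trans (≡.sym (m<n⇒m%n≡m (ℕ.m<n⇒m<1+n n<r))) eq)))
          , pulse≡1 r (m<n⇒m%n≡m (ℕ.n<1+n r))

  X^q≈X : act (pow X (p ℕ.^ suc k)) pulse ≈ act X pulse
  X^q≈X n rewrite p^d≡2+r = ≈ₚ-reflexive (≡.trans (act-X^ (2 ℕ.+ r) pulse n)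
    (≡.trans (≡.cong (pulse ∘ suc) (≡.sym (ℕ.+-suc r n))) (pulse-periodic (suc n))))

  -- The elements with a^q = a form a subring, and it contains the generator X.
  a^q≈a : ∀ a → act (pow a (p ℕ.^ suc k)) pulse ≈ act a pulse
  a^q≈a a = ≡.subst (λ t → act t pulse ≈ act a pulse) (≡.sym (pow≡^ {pulse} a (p ℕ.^ suc k))) (fixed a)
    where
    open FixedByFrobenius (cyclic pulse) prime-p (p×I≈O pulse)
    fixed : ∀ a → Fixed (suc k) a
    fixed O       = fixed-0 (suc k)
    fixed I       = fixed-1 (suc k)
    fixed X       = ≡.subst (λ t → act t pulse ≈ act X pulse) (pow≡^ {pulse} X (p ℕ.^ suc k)) X^q≈X
    fixed (a ⊞ b) = fixed-+ (suc k) {a} {b} (fixed a) (fixed b)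
    fixed (a ⊠ b) = fixed-* (suc k) {a} {b} (fixed a) (fixed b)
    fixed (⊟ a)   = fixed-neg (suc k) {a} (fixed a)

  act-periodic : ∀ a n → act a pulse (N ℕ.+ n) ≈ₚ act a pulse n
  act-periodic a n = ≡.subst (_≈ₚ act a pulse n) (act-X^ N (act a pulse) n)
    (trans (act-comm (pow X N) a pulse) (act-cong a (λ m → ≈ₚ-reflexive (≡.trans (act-X^ N pulse m) (pulse-periodic m)))) n)

  act-% : ∀ a n → act a pulse n ≈ₚ act a pulse (n % N)
  act-% a n = ≡.subst (λ m → act a pulse m ≈ₚ act a pulse (n % N))
    (≡.trans (ℕ.+-comm _ (n % N)) (≡.sym (m≡m%n+[m/n]*n n N))) (periods (n / N))
    where
    periods : ∀ j → act a pulse (j ℕ.* N ℕ.+ n % N) ≈ₚ act a pulse (n % N)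
    periods zero    = ≈ₚ-refl
    periods (suc j) = ≈ₚ-trans
      (≡.subst (λ m → act a pulse m ≈ₚ act a pulse (j ℕ.* N ℕ.+ n % N)) (≡.sym (ℕ.+-assoc N (j ℕ.* N) (n % N)))
        (act-periodic a (j ℕ.* N ℕ.+ n % N)))
      (periods j)

  annihilates : ∀ a → (∀ (m : Fin N) → act a pulse (toℕ m) ≈ₚ 0ℤ) → act a pulse ≈ ε
  annihilates a zero-at n = ≈ₚ-trans (act-% a n)
    (≡.subst (λ m → act a pulse m ≈ₚ 0ℤ) (Fin.toℕ-fromℕ< (m%n<n n N)) (zero-at (fromℕ< (m%n<n n N))))

  -- By periodicity N entries determine the whole sequence, and each of them is tested for
  -- divisibility by p.
  annihilates? : ∀ a → Dec (act a pulse ≈ ε)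
  annihilates? a = map′ (annihilates a) (λ a≈0 m → a≈0 (toℕ m))
    (Fin.all? (λ m → map′ congruent _≡_[mod_].difference (+ p ℤ∣.∣? act a pulse (toℕ m) ℤ.- 0ℤ)))

  -- The polynomials of degree below N with coefficients in {0, ..., p - 1}. They represent every
  -- element modulo X^N - 1, which keeps the settling process finite.
  representative : Fin (p ℕ.^ N) → Term
  representative i = horner (λ j → toℕ (finToFun {p} {N} i j))

  act-horner-pulse : ∀ (c : Fin N → ℕ) m → act (horner c) pulse (toℕ m) ≡ + c (Fin.opposite m)
  act-horner-pulse c m = horner-select c pulse (toℕ m) (Fin.opposite m) off on
    where
    opposite+m : toℕ (Fin.opposite m) ℕ.+ toℕ m ≡ r
    opposite+m = ≡.trans (≡.cong (ℕ._+ toℕ m) (Fin.opposite-prop m)) (ℕ.m∸n+n≡m (ℕ.s≤s⁻¹ (Fin.toℕ<n m)))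
    on : pulse (toℕ (Fin.opposite m) ℕ.+ toℕ m) ≡ 1ℤ
    on = pulse≡1 (toℕ (Fin.opposite m) ℕ.+ toℕ m) (≡.trans (≡.cong (_% N) opposite+m) (m<n⇒m%n≡m (ℕ.n<1+n r)))
    off : ∀ j → ¬ j ≡ Fin.opposite m → pulse (toℕ j ℕ.+ toℕ m) ≡ 0ℤ
    off j j≢ = pulse≡0 (toℕ j ℕ.+ toℕ m) λ eq →
      j≢ (Fin.toℕ-injective (ℕ.+-cancelʳ-≡ (toℕ m) _ _ (≡.trans (small eq) (≡.sym opposite+m))))
      where
      small : (toℕ j ℕ.+ toℕ m) % N ≡ r → toℕ j ℕ.+ toℕ m ≡ r
      small eq with toℕ j ℕ.+ toℕ m ℕ.<? N
      ... | yes lt = ≡.trans (≡.sym (m<n⇒m%n≡m lt)) eq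
      -- j + m is less than r + N, so after wrapping around the remainder is less than r and cannot
      -- hit the 1.
      ... | no ¬lt = contradiction (≡.trans (≡.sym wrapped) eq) (ℕ.<⇒≢ o<r)
        where
        o = toℕ j ℕ.+ toℕ m ℕ.∸ N
        N+o : o ℕ.+ N ≡ toℕ j ℕ.+ toℕ m
        N+o = ℕ.m∸n+n≡m (ℕ.≮⇒≥ ¬lt)
        o<r : o ℕ.< r
        o<r = ℕ.+-cancelʳ-< N o r (≡.subst (ℕ._< r ℕ.+ N) (≡.sym N+o)
                (ℕ.+-mono-≤-< (ℕ.s≤s⁻¹ (Fin.toℕ<n j)) (Fin.toℕ<n m)))
        wrapped : (toℕ j ℕ.+ toℕ m) % N ≡ o
        wrapped = ≡.trans (≡.cong (_% N) (≡.sym N+o))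
          (≡.trans ([m+n]%n≡m%n o N) (m<n⇒m%n≡m (ℕ.m<n⇒m<1+n o<r)))

  represent : ∀ a → ∃ λ i → act (representative i) pulse ≈ act a pulse
  represent a = i , difference (annihilates (representative i ⊞ (⊟ a)) (λ m → agree m))
    where
    open GroupProperties (AbelianGroup.group V) using (x∙y⁻¹≈ε⇒x≈y)
    -- Coefficient j is read off at the opposite position and reduced modulo p.
    residue : Fin N → Fin p
    residue j = fromℕ< (ℤ.n%ℕd<d (act a pulse (toℕ (Fin.opposite j))) p)
    i = funToFin residue
    difference : act (representative i ⊞ (⊟ a)) pulse ≈ ε → act (representative i) pulse ≈ act a pulse
    difference = x∙y⁻¹≈ε⇒x≈y _ _
    value : ∀ m → act (representative i) pulse (toℕ m) ≡ + (act a pulse (toℕ m) ℤ.%ℕ p)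
    value m = ≡.trans (act-horner-pulse (λ j → toℕ (finToFun {p} {N} i j)) m) (≡.cong +_
      (≡.trans (≡.cong toℕ (Fin.finToFun-funToFin residue (Fin.opposite m)))
      (≡.trans (Fin.toℕ-fromℕ< _)
        (≡.cong (λ j → act a pulse (toℕ j) ℤ.%ℕ p) (Fin.opposite-involutive m)))))
    agree : ∀ m → act (representative i) pulse (toℕ m) ℤ.- act a pulse (toℕ m) ≈ₚ 0ℤ
    agree m = ≡.subst (λ v → v ℤ.- act a pulse (toℕ m) ≈ₚ 0ℤ) (≡.sym (value m))
      (congruent (ℤ∣.divides (ℤ.- (x ℤ./ℕ p)) (≡.trans (≡.cong (λ u → ρ ℤ.- u ℤ.- 0ℤ) (ℤ.a≡a%ℕn+[a/ℕn]*n x p))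
        (rearrange ρ (x ℤ./ℕ p) (+ p)))))
      where
      x = act a pulse (toℕ m)
      ρ = + (x ℤ.%ℕ p)
      rearrange : ∀ ρ q p → ρ ℤ.- (ρ ℤ.+ q ℤ.* p) ℤ.- 0ℤ ≡ ℤ.- q ℤ.* p
      rearrange = solve-∀

  -- Acting by ∏_{0<e<d} (X^(p^e) - X) makes each factor a unit, so that no proper power of
  -- Frobenius fixes X; the result is nonzero because the degree of the product is below N.
  frobeniusGap : ℕ → Term
  frobeniusGap e = pow X (p ℕ.^ e) ⊞ (⊟ X)

  gaps : ℕ → Term
  gaps zero    = I
  gaps (suc e) = frobeniusGap (suc e) ⊠ gaps e

  gaps-degree : ℕ → ℕ
  gaps-degree zero    = 0
  gaps-degree (suc e) = p ℕ.^ suc e ℕ.+ gaps-degree e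

  2≤p^ : ∀ e → 2 ℕ.≤ p ℕ.^ suc e
  2≤p^ e = ℕ.≤-trans 2≤p (ℕ.m≤m*n p (p ℕ.^ e) {{ℕ.m^n≢0 p e}})

  -- The sum p + ... + p^e stays two below p^(e+1), by induction from 2 ≤ p. At e = k = d - 1 the
  -- bound becomes r, so the product does not wrap around modulo X^N - 1.
  gaps-degree-bound : ∀ e → 2 ℕ.+ gaps-degree e ℕ.≤ p ℕ.^ suc e
  gaps-degree-bound zero    = 2≤p^ 0
  gaps-degree-bound (suc e) = ℕR.begin
    2 ℕ.+ (p ℕ.^ suc e ℕ.+ gaps-degree e)  ℕR.≡⟨ x∙yz≈y∙xz 2 (p ℕ.^ suc e) (gaps-degree e) ⟩
    p ℕ.^ suc e ℕ.+ (2 ℕ.+ gaps-degree e)  ℕR.≤⟨ ℕ.+-monoʳ-≤ (p ℕ.^ suc e) (gaps-degree-bound e) ⟩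
    p ℕ.^ suc e ℕ.+ p ℕ.^ suc e            ℕR.≡⟨ ≡.cong (p ℕ.^ suc e ℕ.+_) (ℕ.+-identityʳ _) ⟨
    2 ℕ.* p ℕ.^ suc e                      ℕR.≤⟨ ℕ.*-monoˡ-≤ (p ℕ.^ suc e) 2≤p ⟩
    p ℕ.^ suc (suc e)                      ℕR.∎
    where
    module ℕR = ℕ.≤-Reasoning
    open CommutativeSemigroupProperties ℕ.+-commutativeSemigroup using (x∙yz≈y∙xz)

  gaps-leads : ∀ e {s m} → Leads s (gaps-degree e ℕ.+ m) → Leads (act (gaps e) s) m
  gaps-leads zero    leads = leads
  gaps-leads (suc e) {s} {m} leads = binomial-leads (2≤p^ e) (gaps-leads e
    (≡.subst (Leads s) (xy∙z≈y∙xz (p ℕ.^ suc e) (gaps-degree e) m) leads))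
    where open CommutativeSemigroupProperties ℕ.+-commutativeSemigroup using (xy∙z≈y∙xz)

  s₀ : Sequence
  s₀ = act (gaps k) pulse

  s₀≉0 : ¬ (s₀ ≈ ε)
  s₀≉0 s₀≈0 = 1≢0 (≡.subst (_≈ₚ 0ℤ) (proj₂ s₀-leads) (s₀≈0 m))
    where
    degree≤r : gaps-degree k ℕ.≤ r
    degree≤r = ℕ.s≤s⁻¹ (ℕ.s≤s⁻¹ (≡.subst (2 ℕ.+ gaps-degree k ℕ.≤_) p^d≡2+r (gaps-degree-bound k)))
    m = r ℕ.∸ gaps-degree k
    s₀-leads : Leads s₀ m
    s₀-leads = gaps-leads k (≡.subst (Leads pulse) (≡.sym (ℕ.m+[n∸m]≡n degree≤r)) pulse-leads)
    1≢0 : ¬ (1ℤ ≈ₚ 0ℤ)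
    1≢0 (congruent p∣1) = ℕ.<⇒≱ 2≤p (ℕ∣.∣⇒≤ (ℤ∣.∣⇒∣ᵤ p∣1))

  act-fixed : ∀ b a → act (pow a (suc N)) (act b pulse) ≈ act a (act b pulse)
  act-fixed b a = begin
    act (pow a (suc N)) (act b pulse)  ≈⟨ act-comm (pow a (suc N)) b pulse ⟩
    act b (act (pow a (suc N)) pulse)  ≈⟨ act-cong b (≡.subst (λ q → act (pow a q) pulse ≈ act a pulse) p^d≡2+r (a^q≈a a)) ⟩
    act b (act a pulse)                ≈⟨ act-comm b a pulse ⟩
    act a (act b pulse)                ∎

  -- The gap is one of the factors of `gaps j`. On a multiple of a, a^(N+1) = a makes a^N the
  -- identity, and the factors applied later commute with it.
  gap-unit : ∀ {e} j → e ℕ.< j → act (pow (frobeniusGap (suc e)) N) (act (gaps j) pulse) ≈ act (gaps j) pulse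
  gap-unit {e} (suc j) e<j with ℕ.m≤n⇒m<n∨m≡n (ℕ.s≤s⁻¹ e<j)
  ... | inj₁ e<j₁ = begin
    act g (act (frobeniusGap (suc j)) (act (gaps j) pulse))  ≈⟨ act-comm g (frobeniusGap (suc j)) (act (gaps j) pulse) ⟩
    act (frobeniusGap (suc j)) (act g (act (gaps j) pulse))  ≈⟨ act-cong (frobeniusGap (suc j)) (gap-unit j e<j₁) ⟩
    act (frobeniusGap (suc j)) (act (gaps j) pulse)          ∎
    where g = pow (frobeniusGap (suc e)) N
  ... | inj₂ ≡.refl = Settled-self N (frobeniusGap (suc e)) (act-fixed (gaps e) (frobeniusGap (suc e)))

  -- Kept opaque so that type checking never unfolds the search through p^N terms.
  abstract
    settled : ∃ λ b → ¬ (act b s₀ ≈ ε) × (∀ i → Settled N (representative i) (act b s₀))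
    settled = settle N s₀ (λ b → annihilates? (b ⊠ gaps k)) (act-fixed (gaps k)) s₀≉0 representative

  b : Term
  b = proj₁ settled

  s : Sequence
  s = act b s₀

  field-ring : CommutativeRing 0ℓ 0ℓ
  field-ring = cyclic s

  open Exp (CommutativeRing.commutativeSemiring field-ring) using (_^_)

  -- `a` agrees with a settled representative on `pulse`, hence also on `s`, which is a multiple of
  -- `pulse`.
  zero-or-root-of-unity : ∀ a → act a s ≈ ε ⊎ act (a ^ N) s ≈ s
  zero-or-root-of-unity a =
    Sum.map₂ (≡.subst (λ t → act t s ≈ s) (pow≡^ {s} a N))
      (Settled-cong N {representative i} {a} {s} same (proj₂ (proj₂ settled) i))
    where
    i = proj₁ (represent a)
    same : act (representative i) s ≈ act a s
    same = begin
      act (representative i) (act (b ⊠ gaps k) pulse)  ≈⟨ act-comm (representative i) (b ⊠ gaps k) pulse ⟩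
      act (b ⊠ gaps k) (act (representative i) pulse)  ≈⟨ act-cong (b ⊠ gaps k) (proj₂ (represent a)) ⟩
      act (b ⊠ gaps k) (act a pulse)                   ≈⟨ act-comm (b ⊠ gaps k) a pulse ⟩
      act a (act (b ⊠ gaps k) pulse)                   ∎

  1≉0 : ¬ (act I s ≈ ε)
  1≉0 = proj₁ (proj₂ settled)

  -- Otherwise the gap X^(p^e) - X would be zero on `s`, while its N-th power is the identity there.
  X-conjugates : ∀ e → 0 ℕ.< e → e ℕ.< suc k → ¬ (act (X ^ (p ℕ.^ e)) s ≈ act X s)
  X-conjugates (suc e) _ (s≤s e<k) fixed = 1≉0 (begin
    s                ≈⟨ trans (act-comm g b s₀) (act-cong b (gap-unit k e<k)) ⟨
    act g s          ≈⟨ pow-cong {s} {frobeniusGap (suc e)} {O} N gap≈0 ⟩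
    act (pow O N) s  ≡⟨⟩
    ε                ∎)
    where
    open GroupProperties (AbelianGroup.group V) using (x≈y⇒x∙y⁻¹≈ε)
    g = pow (frobeniusGap (suc e)) N
    gap≈0 : act (frobeniusGap (suc e)) s ≈ ε
    gap≈0 = x≈y⇒x∙y⁻¹≈ε (≡.subst (λ t → act t s ≈ act X s) (≡.sym (pow≡^ {s} X (p ℕ.^ suc e))) fixed)

  open FieldOfOrder field-ring {d = suc k} {r = r} prime-p p^d≡2+r (p×I≈O s) 1≉0 zero-or-root-of-unity X X-conjugates
    public using (enumeration)

-- Transport of the field to Fin q, with propositional equality.

record FieldOn (q : ℕ) : Set where
  infix  8 -_
  infixl 7 _*_
  infixl 6 _+_
  field
    _+_ _*_ : Fin q → Fin q → Fin q
    -_      : Fin q → Fin q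
    0# 1#   : Fin q
    isCommutativeRing : IsCommutativeRing _≡_ _+_ _*_ -_ 0# 1#
    1≢0     : 1# ≢ 0#
    inverse : ∀ {x} → x ≢ 0# → ∃ λ y → y * x ≡ 1#

module _ {q : ℕ} (R : CommutativeRing 0ℓ 0ℓ) where

  open CommutativeRing R renaming (refl to ≈-refl)

  module Transport (enumeration : Inverse (≡.setoid (Fin q)) setoid)
    (1≉0 : ¬ 1# ≈ 0#) (invertible : ∀ x → x ≈ 0# ⊎ ∃ λ y → y * x ≈ 1#) where

    open Inverse enumeration using (to; from; from-cong; inverseˡ; inverseʳ)

    to-from : ∀ x → to (from x) ≈ x
    to-from x = inverseˡ refl

    transported : RawRing 0ℓ 0ℓ
    transported = record
      { Carrier = Fin q
      ; _≈_ = _≡_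
      ; _+_ = λ i j → from (to i + to j)
      ; _*_ = λ i j → from (to i * to j)
      ; -_  = λ i → from (- to i)
      ; 0#  = from 0#
      ; 1#  = from 1#
      }

    to-injective : ∀ {i j} → to i ≈ to j → i ≡ j
    to-injective {i} {j} eq = ≡.trans (≡.sym (inverseʳ ≈-refl)) (≡.trans (from-cong eq) (inverseʳ ≈-refl))

    to-isRingMonomorphism : IsRingMonomorphism transported rawRing to
    to-isRingMonomorphism = record
      { isRingHomomorphism = record
        { isSemiringHomomorphism = record
          { isNearSemiringHomomorphism = record
            { +-isMonoidHomomorphism = record
              { isMagmaHomomorphism = record
                { isRelHomomorphism = record { cong = λ { refl → ≈-refl } }
                ; homo = λ _ _ → to-from _
                }
              ; ε-homo = to-from _
              }
            ; *-homo = λ _ _ → to-from _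
            }
          ; 1#-homo = to-from _
          }
        ; -‿homo = λ _ → to-from _
        }
      ; injective = to-injective
      }

    fieldOn : FieldOn q
    fieldOn = record
      { isCommutativeRing = RingMonomorphism.isCommutativeRing to-isRingMonomorphism isCommutativeRing
      ; 1≢0 = λ eq → 1≉0 (trans (sym (to-from 1#)) (trans (reflexive (≡.cong to eq)) (to-from 0#)))
      ; inverse = λ {i} i≢0 → inv i≢0 (invertible (to i))
      }
      where
      inv : ∀ {i} → i ≢ from 0# → to i ≈ 0# ⊎ (∃ λ y → y * to i ≈ 1#) → ∃ λ j → from (to j * to i) ≡ from 1#
      inv i≢0 (inj₁ x≈0)       = contradiction (to-injective (trans x≈0 (sym (to-from 0#)))) i≢0
      inv i≢0 (inj₂ (y , yx≈1)) = from y , from-cong (trans (*-congʳ (to-from y)) yx≈1)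

finiteField : ∀ {p} d → Prime p → .{{_ : NonZero d}} → FieldOn (p ℕ.^ d)
finiteField {p} (suc k) prime-p = Transport.fieldOn field-ring enumeration 1≉0 λ x →
  -- The inverse of a nonzero x is x^(q-2).
  Sum.map₂ (λ root → x ^ r , trans {x ^ r * x} {x * x ^ r} {1#} (*-comm (x ^ r) x) root) (zero-or-root-of-unity x)
  where
  r = p ℕ.^ suc k ℕ.∸ 2
  2≤p^d : 2 ℕ.≤ p ℕ.^ suc k
  2≤p^d = ℕ.≤-trans (ℕ.nonTrivial⇒n>1 p {{prime⇒nonTrivial prime-p}})
    (ℕ.m≤m*n p (p ℕ.^ k) {{ℕ.m^n≢0 p k {{prime⇒nonZero prime-p}}}})
  open Construction {p} {k} {r} prime-p (≡.sym (ℕ.m+[n∸m]≡n 2≤p^d))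
  open CommutativeRing field-ring
  open Exp commutativeSemiring using (_^_)

-- Finite sums of integers.

open ≡ using (cong; cong₂; sym; trans; subst; _≗_)
open ≡.≡-Reasoning

open SemiringSum ℤ.+-*-semiring
  using (sum; sum-cong-≗; ∑-distrib-+; ∑-comm; sum-permute; sum-replicate-zero; *-distribˡ-sum; *-distribʳ-sum)

indicator : Bool → ℤ
indicator b = if b then 1ℤ else 0ℤ

sum-const : ∀ n c → sum {n} (λ _ → c) ≡ + n ℤ.* c
sum-const zero    c = sym (ℤ.*-zeroˡ c)
sum-const (suc n) c = trans (cong (ℤ._+_ c) (sum-const n c)) (sym (ℤ.suc-* (+ n) c))

sum-all-zero : ∀ {n} (f : Fin n → ℤ) → (∀ i → f i ≡ 0ℤ) → sum f ≡ 0ℤ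
sum-all-zero {n} f f≡0 = trans (sum-cong-≗ f≡0) (sum-replicate-zero n)

sum-select : ∀ {n} (f : Fin n → ℤ) c → (∀ i → i ≢ c → f i ≡ 0ℤ) → sum f ≡ f c
sum-select f zero    off = trans (cong (ℤ._+_ (f zero)) (sum-all-zero (f ∘ suc) (λ i → off (suc i) λ ()))) (ℤ.+-identityʳ _)
sum-select f (suc c) off = trans (cong₂ ℤ._+_ (off zero λ ()) (sum-select (f ∘ suc) c (λ i i≢c → off (suc i) (i≢c ∘ Fin.suc-injective)))) (ℤ.+-identityˡ _)

δ-same : ∀ {m} (i : Fin m) → δ i i ≡ 1ℤ
δ-same i = cong indicator (dec-true (i Fin.≟ i) refl)

δ-diff : ∀ {m} {i j : Fin m} → i ≢ j → δ i j ≡ 0ℤ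
δ-diff {i = i} {j} i≢j = cong indicator (dec-false (i Fin.≟ j) i≢j)

sum-δ : ∀ {n} (i : Fin n) c → sum (λ l → δ l i ℤ.* c) ≡ c
sum-δ i c = begin
  sum (λ l → δ l i ℤ.* c)  ≡⟨ sum-select (λ l → δ l i ℤ.* c) i (λ l l≢i → trans (cong (ℤ._* c) (δ-diff l≢i)) (ℤ.*-zeroˡ c)) ⟩
  δ i i ℤ.* c              ≡⟨ cong (ℤ._* c) (δ-same i) ⟩
  1ℤ ℤ.* c                 ≡⟨ ℤ.*-identityˡ c ⟩
  c                        ∎

sum-one-exception : ∀ {n} (f : Fin n → ℤ) i {u v} → f i ≡ u → (∀ l → l ≢ i → f l ≡ v) →
                    sum f ≡ u ℤ.+ (+ n ℤ.- 1ℤ) ℤ.* v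
sum-one-exception {n} f i {u} {v} fi≡u fl≡v = begin
  sum f                                                ≡⟨ sum-cong-≗ pointwise ⟩
  sum (λ l → v ℤ.+ δ l i ℤ.* (u ℤ.- v))                ≡⟨ ∑-distrib-+ (λ _ → v) (λ l → δ l i ℤ.* (u ℤ.- v)) ⟩
  sum {n} (λ _ → v) ℤ.+ sum (λ l → δ l i ℤ.* (u ℤ.- v)) ≡⟨ cong₂ ℤ._+_ (sum-const n v) (sum-δ i (u ℤ.- v)) ⟩
  + n ℤ.* v ℤ.+ (u ℤ.- v)                              ≡⟨ rearrange (+ n) u v ⟩
  u ℤ.+ (+ n ℤ.- 1ℤ) ℤ.* v                             ∎
  where
  at : ∀ u v → u ≡ v ℤ.+ 1ℤ ℤ.* (u ℤ.- v)
  at = solve-∀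
  off : ∀ u v → v ≡ v ℤ.+ 0ℤ ℤ.* (u ℤ.- v)
  off = solve-∀
  rearrange : ∀ n u v → n ℤ.* v ℤ.+ (u ℤ.- v) ≡ u ℤ.+ (n ℤ.- 1ℤ) ℤ.* v
  rearrange = solve-∀
  pointwise : ∀ l → f l ≡ v ℤ.+ δ l i ℤ.* (u ℤ.- v)
  pointwise l with l Fin.≟ i
  ... | yes refl = trans fi≡u (at u v)
  ... | no l≢i   = trans (fl≡v l l≢i) (off u v)

-- Made for the sum over l in an entry with i ≠ j. The auxiliary `g` is `f` with the exception at j
-- removed, so the case of one exception applies to it.
sum-two-exceptions : ∀ {n} (f : Fin n → ℤ) i j {u u′ v} → i ≢ j → f i ≡ u → f j ≡ u′ →
                     (∀ l → l ≢ i → l ≢ j → f l ≡ v) →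
                     sum f ≡ u ℤ.+ u′ ℤ.+ (+ n ℤ.- + 2) ℤ.* v
sum-two-exceptions {n} f i j {u} {u′} {v} i≢j fi≡u fj≡u′ fl≡v = begin
  sum f                                    ≡⟨ sum-cong-≗ pointwise ⟩
  sum (λ l → g l ℤ.+ δ l j ℤ.* (u′ ℤ.- v)) ≡⟨ ∑-distrib-+ g (λ l → δ l j ℤ.* (u′ ℤ.- v)) ⟩
  sum g ℤ.+ sum (λ l → δ l j ℤ.* (u′ ℤ.- v))
    ≡⟨ cong₂ ℤ._+_ (sum-one-exception g i (g-at i refl) (λ l l≢i → g-off l l≢i)) (sum-δ j (u′ ℤ.- v)) ⟩
  u ℤ.+ (+ n ℤ.- 1ℤ) ℤ.* v ℤ.+ (u′ ℤ.- v)  ≡⟨ rearrange (+ n) u u′ v ⟩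
  u ℤ.+ u′ ℤ.+ (+ n ℤ.- + 2) ℤ.* v         ∎
  where
  g : Fin n → ℤ
  g l = if does (l Fin.≟ i) then u else v
  g-at : ∀ l → l ≡ i → g l ≡ u
  g-at l l≡i = cong (if_then u else v) (dec-true (l Fin.≟ i) l≡i)
  g-off : ∀ l → l ≢ i → g l ≡ v
  g-off l l≢i = cong (if_then u else v) (dec-false (l Fin.≟ i) l≢i)
  rearrange : ∀ n u u′ v → u ℤ.+ (n ℤ.- 1ℤ) ℤ.* v ℤ.+ (u′ ℤ.- v) ≡ u ℤ.+ u′ ℤ.+ (n ℤ.- + 2) ℤ.* v
  rearrange = solve-∀
  at : ∀ u v → u ≡ v ℤ.+ 1ℤ ℤ.* (u ℤ.- v)
  at = solve-∀
  off : ∀ u w → u ≡ u ℤ.+ 0ℤ ℤ.* w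
  off = solve-∀
  pointwise : ∀ l → f l ≡ g l ℤ.+ δ l j ℤ.* (u′ ℤ.- v)
  pointwise l with l Fin.≟ i | l Fin.≟ j
  ... | yes refl | yes refl = contradiction refl i≢j
  ... | yes refl | no _     = trans fi≡u (off u (u′ ℤ.- v))
  ... | no _     | yes refl = trans fj≡u′ (at u′ v)
  ... | no l≢i   | no l≢j   = trans (fl≡v l l≢i l≢j) (off v (u′ ℤ.- v))

sum-++ : ∀ m {n} (f : Fin (m ℕ.+ n) → ℤ) → sum f ≡ sum (λ i → f (i Fin.↑ˡ n)) ℤ.+ sum (λ j → f (m Fin.↑ʳ j))
sum-++ zero    f = sym (ℤ.+-identityˡ _)
sum-++ (suc m) f = trans (cong (ℤ._+_ (f zero)) (sum-++ m (f ∘ suc))) (sym (ℤ.+-assoc (f zero) _ _))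

sum-combine : ∀ m n (f : Fin (m ℕ.* n) → ℤ) → sum f ≡ sum (λ i → sum (λ j → f (combine {m} {n} i j)))
sum-combine zero    n f = refl
sum-combine (suc m) n f = trans (sum-++ n f) (cong (ℤ._+_ (sum (λ j → f (j Fin.↑ˡ (m ℕ.* n)))))
  (sum-combine m n (λ i → f (n Fin.↑ʳ i))))

-- If `y` were missed, punching it out would inject Fin (n + 1) into Fin n.
injective⇒surjective : ∀ {n} {π : Fin n → Fin n} → Injective _≡_ _≡_ π → ∀ y → ∃ λ x → π x ≡ y
injective⇒surjective {suc n} {π} π-injective y with Fin.any? (λ x → π x Fin.≟ y)
... | yes found = found
... | no missed = contradiction (Fin.injective⇒≤ {f = λ x → punchOut (y≢π x)}
        (λ {a} {b} eq → π-injective (Fin.punchOut-injective (y≢π a) (y≢π b) eq))) ℕ.1+n≰n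
  where
  y≢π : ∀ x → y ≢ π x
  y≢π x y≡πx = missed (x , sym y≡πx)

sum-injective : ∀ {n} (f : Fin n → ℤ) {π : Fin n → Fin n} → Injective _≡_ _≡_ π → sum (f ∘ π) ≡ sum f
sum-injective f {π} π-injective = sym (sum-permute f (mk↔ₛ′ π (proj₁ ∘ surjective) (proj₂ ∘ surjective)
  (λ x → π-injective (proj₂ (surjective (π x))))))
  where surjective = injective⇒surjective π-injective

sum-prefix : ∀ z n → z ℕ.≤ n → sum {n} (λ i → indicator (toℕ i ℕ.<ᵇ z)) ≡ + z
sum-prefix zero    n       _         = sum-all-zero {n} _ (λ _ → refl)
sum-prefix (suc z) (suc n) (s≤s z≤n′) = cong (ℤ._+_ 1ℤ) (sum-prefix z n z≤n′)

pos-sum : ∀ {n} (f : Fin n → ℕ) → + CommutativeMonoidSum.sum ℕ.+-0-commutativeMonoid f ≡ sum (λ i → + f i)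
pos-sum {zero}  f = refl
pos-sum {suc n} f = trans (ℤ.pos-+ (f zero) _) (cong (ℤ._+_ (+ f zero)) (pos-sum (f ∘ suc)))

-- The plane over K, its lines and convolution.

module Plane {q} (K : FieldOn q) where

  open FieldOn K public

  fieldRing : CommutativeRing 0ℓ 0ℓ
  fieldRing = record { isCommutativeRing = isCommutativeRing }

  open CommutativeRing fieldRing using
    (_-_; +-group; +-abelianGroup; ring; +-assoc; +-comm; +-identityˡ; +-identityʳ; -‿inverseˡ; -‿inverseʳ
    ; *-assoc; *-identityˡ; *-identityʳ; zeroʳ; +-commutativeSemigroup)
  open GroupProperties +-group using (x∙y⁻¹≈ε⇒x≈y; x≈y⇒x∙y⁻¹≈ε; ⁻¹-injective; ∙-cancelˡ; ε⁻¹≈ε)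
  open AbelianGroupProperties +-abelianGroup using (⁻¹-∙-comm)
  open RingProperties ring using (x[y-z]≈xy-xz; [y-z]x≈yx-zx)
  open CommutativeSemigroupProperties +-commutativeSemigroup using (interchange)

  Point : Set
  Point = Fin q × Fin q

  0ₚ : Point
  0ₚ = 0# , 0#

  planeGroup : FiniteAbelianGroup (q ℕ.* q)
  planeGroup = record
    { abelianGroup = record
      { Carrier = Point
      ; _≈_ = _≡_
      ; _∙_ = λ (a , b) (c , d) → a + c , b + d
      ; ε   = 0ₚ
      ; _⁻¹ = λ (a , b) → - a , - b
      ; isAbelianGroup = record
        { isGroup = record
          { isMonoid = record
            { isSemigroup = record
              { isMagma = record { isEquivalence = ≡.isEquivalence ; ∙-cong = λ { refl refl → refl } }
              ; assoc = λ _ _ _ → cong₂ _,_ (+-assoc _ _ _) (+-assoc _ _ _)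
              }
            ; identity = (λ _ → cong₂ _,_ (+-identityˡ _) (+-identityˡ _))
                       , (λ _ → cong₂ _,_ (+-identityʳ _) (+-identityʳ _))
            }
          ; inverse = (λ _ → cong₂ _,_ (-‿inverseˡ _) (-‿inverseˡ _))
                    , (λ _ → cong₂ _,_ (-‿inverseʳ _) (-‿inverseʳ _))
          ; ⁻¹-cong = cong (λ (a , b) → - a , - b)
          }
        ; comm = λ _ _ → cong₂ _,_ (+-comm _ _) (+-comm _ _)
        }
      }
    ; enumeration = Fin.*↔×
    }

  open FiniteAbelianGroup planeGroup public using (elem; index; _≟_; index-injective)
  open AbelianGroup (FiniteAbelianGroup.abelianGroup planeGroup) using () renaming (group to pointGroup)
  open AbelianGroup (FiniteAbelianGroup.abelianGroup planeGroup) public using () renaming (_-_ to _-ₚ_)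

  -- The lines through 0ₚ are the kernels of the functionals φ ℓ; zero is the line x = 0
  -- and suc m the line y = m x.
  φ : Fin (suc q) → Point → Fin q
  φ zero    (x , y) = x
  φ (suc m) (x , y) = y - m * x

  φ-minus : ∀ ℓ u v → φ ℓ (u -ₚ v) ≡ φ ℓ u - φ ℓ v
  φ-minus zero    _ _ = refl
  φ-minus (suc m) (x , y) (x′ , y′) = begin
    (y - y′) - m * (x - x′)              ≡⟨ cong (λ e → (y - y′) - e) (x[y-z]≈xy-xz m x x′) ⟩
    (y - y′) - (m * x - m * x′)          ≡⟨ cong (λ e → (y - y′) + e) (⁻¹-∙-comm (m * x) (- (m * x′))) ⟨
    (y - y′) + (- (m * x) - - (m * x′))  ≡⟨ interchange y (- y′) (- (m * x)) (- - (m * x′)) ⟩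
    (y - m * x) + (- y′ - - (m * x′))    ≡⟨ cong (λ e → (y - m * x) + e) (⁻¹-∙-comm y′ (- (m * x′))) ⟩
    (y - m * x) - (y′ - m * x′)          ∎

  φ-0 : ∀ ℓ → φ ℓ 0ₚ ≡ 0#
  φ-0 zero    = refl
  φ-0 (suc m) = x≈y⇒x∙y⁻¹≈ε (sym (zeroʳ m))

  *-cancel-0 : ∀ {a x} → a ≢ 0# → a * x ≡ 0# → x ≡ 0#
  *-cancel-0 {a} {x} a≢0 ax≡0 with inverse a≢0
  ... | b , ba≡1 = begin
    x              ≡⟨ *-identityˡ x ⟨
    1# * x         ≡⟨ cong (_* x) ba≡1 ⟨
    b * a * x      ≡⟨ *-assoc b a x ⟩
    b * (a * x)    ≡⟨ cong (b *_) ax≡0 ⟩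
    b * 0#         ≡⟨ zeroʳ b ⟩
    0#             ∎

  φ-kernel-x≡0 : ∀ m {v} → proj₁ v ≡ 0# → φ (suc m) v ≡ 0# → v ≡ 0ₚ
  φ-kernel-x≡0 m {x , y} refl y-mx≡0 = cong (x ,_) (trans (x∙y⁻¹≈ε⇒x≈y y (m * x) y-mx≡0) (zeroʳ m))

  φ-kernels : ∀ {ℓ ℓ′} → ℓ ≢ ℓ′ → ∀ {v} → φ ℓ v ≡ 0# → φ ℓ′ v ≡ 0# → v ≡ 0ₚ
  φ-kernels {zero}  {zero}   ℓ≢ℓ′ _ _ = contradiction refl ℓ≢ℓ′
  φ-kernels {zero}  {suc m}  _ x≡0 y-mx≡0 = φ-kernel-x≡0 m x≡0 y-mx≡0
  φ-kernels {suc m} {zero}   _ y-mx≡0 x≡0 = φ-kernel-x≡0 m x≡0 y-mx≡0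
  φ-kernels {suc m} {suc m′} ℓ≢ℓ′ {x , y} y-mx≡0 y-m′x≡0 = φ-kernel-x≡0 m x≡0 y-mx≡0
    where
    x≡0 : x ≡ 0#
    x≡0 = *-cancel-0 {m - m′} (λ eq → ℓ≢ℓ′ (cong suc (x∙y⁻¹≈ε⇒x≈y m m′ eq))) (begin
      (m - m′) * x       ≡⟨ [y-z]x≈yx-zx x m m′ ⟩
      m * x - m′ * x     ≡⟨ cong₂ _-_ (x∙y⁻¹≈ε⇒x≈y y (m * x) y-mx≡0) (x∙y⁻¹≈ε⇒x≈y y (m′ * x) y-m′x≡0) ⟨
      y - y              ≡⟨ -‿inverseʳ y ⟩
      0#                 ∎)

  φ-jointly-injective : ∀ {ℓ ℓ′} → ℓ ≢ ℓ′ → ∀ {u v} → φ ℓ u ≡ φ ℓ v → φ ℓ′ u ≡ φ ℓ′ v → u ≡ v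
  φ-jointly-injective {ℓ} {ℓ′} ℓ≢ℓ′ {u} {v} eq eq′ = GroupProperties.x∙y⁻¹≈ε⇒x≈y pointGroup u v
    (φ-kernels ℓ≢ℓ′ (trans (φ-minus ℓ u v) (x≈y⇒x∙y⁻¹≈ε eq)) (trans (φ-minus ℓ′ u v) (x≈y⇒x∙y⁻¹≈ε eq′)))

  line : ∀ v → ∃ λ ℓ → φ ℓ v ≡ 0#
  line (x , y) with x Fin.≟ 0#
  ... | yes x≡0 = zero , x≡0
  ... | no x≢0 with inverse x≢0
  ...   | b , bx≡1 = suc (y * b) , x≈y⇒x∙y⁻¹≈ε (sym (begin
    y * b * x    ≡⟨ *-assoc y b x ⟩
    y * (b * x)  ≡⟨ cong (y *_) bx≡1 ⟩
    y * 1#       ≡⟨ *-identityʳ y ⟩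
    y            ∎))

  -- At `0ₚ`, which lies on every line, the value is an arbitrary choice; statements about it
  -- exclude that point.
  lineOf : Point → Fin (suc q)
  lineOf v = proj₁ (line v)

  line-unique : ∀ {v ℓ} → v ≢ 0ₚ → φ ℓ v ≡ 0# → ℓ ≡ lineOf v
  line-unique {v} {ℓ} v≢0 φv≡0 with ℓ Fin.≟ lineOf v
  ... | yes eq = eq
  ... | no neq = contradiction (φ-kernels neq φv≡0 (proj₂ (line v))) v≢0

  another-line : ∀ (ℓ : Fin (suc q)) → ∃ λ ℓ′ → ℓ ≢ ℓ′
  another-line zero    = suc 0# , λ ()
  another-line (suc m) = zero , λ ()

  ∑ₚ : (Point → ℤ) → ℤ
  ∑ₚ f = sum (λ i → f (elem i))

  index-elem : ∀ i → index (elem i) ≡ i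
  index-elem i = Fin.combine-remQuot {q} q i

  elem-index : ∀ v → elem (index v) ≡ v
  elem-index (x , y) = Fin.remQuot-combine x y

  -- Two distinct functionals are coordinates: the map v ↦ (φ ℓ v, φ ℓ′ v) is injective on a finite
  -- set, hence a permutation of the plane.
  ∑ₚ-φφ : ∀ {ℓ ℓ′} → ℓ ≢ ℓ′ → (F : Fin q → Fin q → ℤ) →
          ∑ₚ (λ v → F (φ ℓ v) (φ ℓ′ v)) ≡ sum (λ a → sum (F a))
  ∑ₚ-φφ {ℓ} {ℓ′} ℓ≢ℓ′ F = begin
    sum (λ i → F (φ ℓ (elem i)) (φ ℓ′ (elem i)))
      ≡⟨ sum-cong-≗ (λ i → cong (uncurry F) (elem-index (φφ (elem i)))) ⟨
    sum (λ i → uncurry F (elem (π i)))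
      ≡⟨ sum-injective (λ i → uncurry F (elem i)) π-injective ⟩
    sum (λ i → uncurry F (elem i))
      ≡⟨ sum-combine q q (λ i → uncurry F (elem i)) ⟩
    sum (λ a → sum (λ b → uncurry F (elem (combine {q} {q} a b))))
      ≡⟨ sum-cong-≗ (λ a → sum-cong-≗ (λ b → cong (uncurry F) (elem-index (a , b)))) ⟩
    sum (λ a → sum (F a))
      ∎
    where
    φφ : Point → Point
    φφ v = φ ℓ v , φ ℓ′ v
    π : Fin (q ℕ.* q) → Fin (q ℕ.* q)
    π i = index (φφ (elem i))
    π-injective : Injective _≡_ _≡_ π
    π-injective {i} {j} eq = begin
      i               ≡⟨ index-elem i ⟨
      index (elem i)  ≡⟨ cong index (φ-jointly-injective ℓ≢ℓ′ (cong proj₁ same) (cong proj₂ same)) ⟩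
      index (elem j)  ≡⟨ index-elem j ⟩
      j               ∎
      where
      same : φφ (elem i) ≡ φφ (elem j)
      same = index-injective eq

  ∑ₚ-φ : ∀ ℓ (f : Fin q → ℤ) → ∑ₚ (f ∘ φ ℓ) ≡ + q ℤ.* sum f
  ∑ₚ-φ ℓ f with another-line ℓ
  ... | ℓ′ , ℓ≢ℓ′ = begin
    ∑ₚ (f ∘ φ ℓ)                  ≡⟨ ∑ₚ-φφ ℓ≢ℓ′ (λ a _ → f a) ⟩
    sum (λ a → sum {q} (λ _ → f a))  ≡⟨ sum-cong-≗ (λ a → sum-const q (f a)) ⟩
    sum (λ a → + q ℤ.* f a)       ≡⟨ *-distribˡ-sum (+ q) f ⟨
    + q ℤ.* sum f                 ∎

  conv : (Point → ℤ) → (Point → ℤ) → Point → ℤ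
  conv f g x = ∑ₚ (λ y → f y ℤ.* g (x -ₚ y))

  -- The weighted form of LL′ = G. In the coordinates φ ℓ and φ ℓ′ the sum factors, and b ↦ c - b
  -- merely permutes the second factor.
  conv-distinct : ∀ {ℓ ℓ′} → ℓ ≢ ℓ′ → (f g : Fin q → ℤ) → ∀ x →
                  conv (f ∘ φ ℓ) (g ∘ φ ℓ′) x ≡ sum f ℤ.* sum g
  conv-distinct {ℓ} {ℓ′} ℓ≢ℓ′ f g x = begin
    ∑ₚ (λ y → f (φ ℓ y) ℤ.* g (φ ℓ′ (x -ₚ y)))
      ≡⟨ sum-cong-≗ (λ i → cong (λ e → f (φ ℓ (elem i)) ℤ.* g e) (φ-minus ℓ′ x (elem i))) ⟩
    ∑ₚ (λ y → f (φ ℓ y) ℤ.* g (c - φ ℓ′ y))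
      ≡⟨ ∑ₚ-φφ ℓ≢ℓ′ (λ a b → f a ℤ.* g (c - b)) ⟩
    sum (λ a → sum (λ b → f a ℤ.* g (c - b)))
      ≡⟨ sum-cong-≗ (λ a → *-distribˡ-sum (f a) (λ b → g (c - b))) ⟨
    sum (λ a → f a ℤ.* sum (λ b → g (c - b)))
      ≡⟨ sum-cong-≗ (λ a → cong (f a ℤ.*_) (sum-injective g reflect)) ⟩
    sum (λ a → f a ℤ.* sum g)
      ≡⟨ *-distribʳ-sum (sum g) f ⟨
    sum f ℤ.* sum g
      ∎
    where
    c = φ ℓ′ x
    reflect : Injective _≡_ _≡_ (λ b → c - b)
    reflect eq = ⁻¹-injective (∙-cancelˡ c _ _ eq)

  -- `κ ∘ φ ℓ` is the characteristic function of the line ℓ, and `f ∘ φ ℓ` in general is a weighted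
  -- sum of its translates.
  κ : Fin q → ℤ
  κ a = δ a 0#

  sum-κ : sum κ ≡ 1ℤ
  sum-κ = trans (sum-select κ 0# (λ _ → δ-diff)) (δ-same 0#)

  -- The weighted form of LL = qL: only the translate of ℓ through `x` contributes, once for each of
  -- its q points.
  conv-same : ∀ ℓ (f : Fin q → ℤ) x → conv (f ∘ φ ℓ) (κ ∘ φ ℓ) x ≡ + q ℤ.* f (φ ℓ x)
  conv-same ℓ f x = begin
    ∑ₚ (λ y → f (φ ℓ y) ℤ.* κ (φ ℓ (x -ₚ y)))
      ≡⟨ sum-cong-≗ (λ i → cong (λ e → f (φ ℓ (elem i)) ℤ.* κ e) (φ-minus ℓ x (elem i))) ⟩
    ∑ₚ (λ y → f (φ ℓ y) ℤ.* κ (c - φ ℓ y))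
      ≡⟨ ∑ₚ-φ ℓ (λ a → f a ℤ.* κ (c - a)) ⟩
    + q ℤ.* sum (λ a → f a ℤ.* κ (c - a))
      ≡⟨ cong (+ q ℤ.*_) (sum-select (λ a → f a ℤ.* κ (c - a)) c off) ⟩
    + q ℤ.* (f c ℤ.* κ (c - c))
      ≡⟨ cong (λ e → + q ℤ.* (f c ℤ.* e)) (trans (cong κ (-‿inverseʳ c)) (δ-same 0#)) ⟩
    + q ℤ.* (f c ℤ.* 1ℤ)
      ≡⟨ cong (+ q ℤ.*_) (ℤ.*-identityʳ (f c)) ⟩
    + q ℤ.* f c
      ∎
    where
    c = φ ℓ x
    off : ∀ a → a ≢ c → f a ℤ.* κ (c - a) ≡ 0ℤ
    off a a≢c = trans (cong (f a ℤ.*_) (δ-diff (λ eq → a≢c (sym (x∙y⁻¹≈ε⇒x≈y c a eq))))) (ℤ.*-zeroʳ (f a))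

  ε₀ : Point → ℤ
  ε₀ x = indicator (does (x ≟ 0ₚ))

  ε₀-0 : ε₀ 0ₚ ≡ 1ℤ
  ε₀-0 = cong indicator (dec-true (0ₚ ≟ 0ₚ) refl)

  ε₀-≢ : ∀ {x} → x ≢ 0ₚ → ε₀ x ≡ 0ℤ
  ε₀-≢ {x} x≢0 = cong indicator (dec-false (x ≟ 0ₚ) x≢0)

  ∑ₚ-select : ∀ (f : Point → ℤ) x → (∀ y → y ≢ x → f y ≡ 0ℤ) → ∑ₚ f ≡ f x
  ∑ₚ-select f x off = trans
    (sum-select (λ i → f (elem i)) (index x) (λ i i≢ → off (elem i) (λ { refl → i≢ (sym (index-elem i)) })))
    (cong f (elem-index x))

  ∑ₚ-ε₀ : ∑ₚ ε₀ ≡ 1ℤ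
  ∑ₚ-ε₀ = trans (∑ₚ-select ε₀ 0ₚ (λ _ → ε₀-≢)) ε₀-0

  open AbelianGroup (FiniteAbelianGroup.abelianGroup planeGroup) using () renaming (identityʳ to +ₚ-identityʳ; inverseʳ to +ₚ-inverseʳ)

  conv-ε₀ʳ : ∀ f x → conv f ε₀ x ≡ f x
  conv-ε₀ʳ f x = begin
    conv f ε₀ x              ≡⟨ ∑ₚ-select (λ y → f y ℤ.* ε₀ (x -ₚ y)) x off ⟩
    f x ℤ.* ε₀ (x -ₚ x)      ≡⟨ cong (f x ℤ.*_) (trans (cong ε₀ (+ₚ-inverseʳ x)) ε₀-0) ⟩
    f x ℤ.* 1ℤ               ≡⟨ ℤ.*-identityʳ (f x) ⟩
    f x                      ∎
    where
    off : ∀ y → y ≢ x → f y ℤ.* ε₀ (x -ₚ y) ≡ 0ℤ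
    off y y≢x = trans (cong (f y ℤ.*_) (ε₀-≢ (λ eq → y≢x (sym (GroupProperties.x∙y⁻¹≈ε⇒x≈y pointGroup x y eq))))) (ℤ.*-zeroʳ (f y))

  conv-ε₀ˡ : ∀ g x → conv ε₀ g x ≡ g x
  conv-ε₀ˡ g x = begin
    conv ε₀ g x              ≡⟨ ∑ₚ-select (λ y → ε₀ y ℤ.* g (x -ₚ y)) 0ₚ off ⟩
    ε₀ 0ₚ ℤ.* g (x -ₚ 0ₚ)    ≡⟨ cong₂ ℤ._*_ ε₀-0 (cong g (trans (cong (λ z → proj₁ x + proj₁ z , proj₂ x + proj₂ z) (cong₂ _,_ ε⁻¹≈ε ε⁻¹≈ε)) (+ₚ-identityʳ x))) ⟩
    1ℤ ℤ.* g x               ≡⟨ ℤ.*-identityˡ (g x) ⟩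
    g x                      ∎
    where
    off : ∀ y → y ≢ 0ₚ → ε₀ y ℤ.* g (x -ₚ y) ≡ 0ℤ
    off y y≢0 = trans (cong (ℤ._* g (x -ₚ y)) (ε₀-≢ y≢0)) (ℤ.*-zeroˡ (g (x -ₚ y)))

-- The partial sum family and its product identities.

module Family {q} (K : FieldOn q) {z w z₂ : ℕ} (zw≡1+q : z ℕ.* w ≡ suc q) (first : Fin w)
  -- For z = 1 one has w = q + 1, and z₂ may exceed q; but then there are no off-diagonal sets, so
  -- the bound is asked for only when two classes exist.
  (z₂≤q : ∀ {i j : Fin z} → i ≢ j → z₂ ℕ.≤ q)
  (quadratic : + z₂ ℤ.* + z₂ ℤ.+ + w ℤ.* + w ℤ.- + w ≡ (+ 2 ℤ.* + w ℤ.- 1ℤ) ℤ.* + z₂)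
  where

  open Plane K
  open FiniteSubset planeGroup
  open GroupRing planeGroup

  private
    Q W Z Z₂ : ℤ
    Q  = + q
    W  = + w
    Z  = + z
    Z₂ = + z₂

  member : Fin z → Fin w → Fin (suc q)
  member i a = cast zw≡1+q (combine i a)

  class : Fin (suc q) → Fin z
  class ℓ = proj₁ (remQuot {z} w (cast (sym zw≡1+q) ℓ))

  position : Fin (suc q) → Fin w
  position ℓ = proj₂ (remQuot {z} w (cast (sym zw≡1+q) ℓ))

  cast-inverse : ∀ {m n} (eq : m ≡ n) (eq′ : n ≡ m) i → cast eq (cast eq′ i) ≡ i
  cast-inverse eq eq′ i = trans (Fin.cast-trans eq′ eq i) (Fin.cast-is-id _ i)

  remQuot-member : ∀ i a → remQuot {z} w (cast (sym zw≡1+q) (member i a)) ≡ (i , a)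
  remQuot-member i a = trans (cong (remQuot {z} w) (cast-inverse (sym zw≡1+q) zw≡1+q (combine i a))) (Fin.remQuot-combine i a)

  class-member : ∀ i a → class (member i a) ≡ i
  class-member i a = cong proj₁ (remQuot-member i a)

  position-member : ∀ i a → position (member i a) ≡ a
  position-member i a = cong proj₂ (remQuot-member i a)

  member-class : ∀ ℓ → member (class ℓ) (position ℓ) ≡ ℓ
  member-class ℓ = trans (cong (cast zw≡1+q) (Fin.combine-remQuot {z} w (cast (sym zw≡1+q) ℓ))) (cast-inverse zw≡1+q (sym zw≡1+q) ℓ)

  members-of-classes : ∀ {i j a b} → i ≢ j → member i a ≢ member j b
  members-of-classes {i} {j} {a} {b} i≢j eq = i≢j (trans (sym (class-member i a)) (trans (cong class eq) (class-member j b)))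

  members-of-class : ∀ {i a b} → a ≢ b → member i a ≢ member i b
  members-of-class {i} {a} {b} a≢b eq = a≢b (trans (sym (position-member i a)) (trans (cong position eq) (position-member i b)))

  toSubset : (Point → Bool) → Subset
  toSubset f = record { to = f ; cong = cong f }

  -- The translates in `offDiagonal i` are those on which the functional takes one of the first z₂
  -- values; the identities see this choice only through the number z₂.
  diagonal offDiagonal : Fin z → Subset
  diagonal i    = toSubset λ x → not (does (x ≟ 0ₚ)) ∧ does (class (lineOf x) Fin.≟ i)
  offDiagonal i = toSubset λ x → toℕ (φ (member i first) x) ℕ.<ᵇ z₂

  S : Fin z → Fin z → Subset
  S i j = if does (i Fin.≟ j) then diagonal i else offDiagonal i

  S-same : ∀ i → S i i ≡ diagonal i
  S-same i = cong (if_then diagonal i else offDiagonal i) (dec-true (i Fin.≟ i) refl)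

  S-diff : ∀ {i j} → i ≢ j → S i j ≡ offDiagonal i
  S-diff {i} {j} i≢j = cong (if_then diagonal i else offDiagonal i) (dec-false (i Fin.≟ j) i≢j)

  h : Fin q → ℤ
  h a = indicator (toℕ a ℕ.<ᵇ z₂)

  sum-h : ∀ {i j : Fin z} → i ≢ j → sum h ≡ Z₂
  sum-h i≢j = sum-prefix z₂ q (z₂≤q i≢j)

  -- `D i` is the sum of the w lines of class i minus w copies of 0, the point they share. In this
  -- linear form the convolution rules for lines apply.
  T′ D : Fin z → Point → ℤ
  T′ i  = h ∘ φ (member i first)
  D i x = sum (λ a → κ (φ (member i a) x)) ℤ.+ ℤ.- W ℤ.* ε₀ x

  -- A nonzero point lies on exactly one line, so at most one summand survives, and it is 1 exactly
  -- when that line is in class i.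
  ⟦diagonal⟧ : ∀ i x → ⟦ diagonal i ⟧ ⟨$⟩ x ≡ D i x
  ⟦diagonal⟧ i x with x ≟ 0ₚ
  ... | yes refl = begin
    ⟦ diagonal i ⟧ ⟨$⟩ 0ₚ
      ≡⟨ cong (λ b → indicator (not b ∧ does (class (lineOf 0ₚ) Fin.≟ i))) (dec-true (0ₚ ≟ 0ₚ) refl) ⟩
    0ℤ
      ≡⟨ cancel W ⟨
    W ℤ.* 1ℤ ℤ.+ ℤ.- W ℤ.* 1ℤ
      ≡⟨ cong₂ (λ u v → u ℤ.+ ℤ.- W ℤ.* v)
           (trans (sum-cong-≗ (λ a → trans (cong κ (φ-0 (member i a))) (δ-same 0#))) (sum-const w 1ℤ)) ε₀-0 ⟨
    D i 0ₚ
      ∎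
    where
    cancel : ∀ W → W ℤ.* 1ℤ ℤ.+ ℤ.- W ℤ.* 1ℤ ≡ 0ℤ
    cancel = solve-∀
  ... | no x≢0 = begin
    ⟦ diagonal i ⟧ ⟨$⟩ x       ≡⟨ cong (λ b → indicator (not b ∧ does (class (lineOf x) Fin.≟ i))) (dec-false (x ≟ 0ₚ) x≢0) ⟩
    δ (class (lineOf x)) i     ≡⟨ on-line ⟨
    sum χ                      ≡⟨ drop W (sum χ) ⟨
    sum χ ℤ.+ ℤ.- W ℤ.* 0ℤ     ≡⟨ cong (λ e → sum χ ℤ.+ ℤ.- W ℤ.* e) (ε₀-≢ x≢0) ⟨
    D i x                      ∎
    where
    χ : Fin w → ℤ
    χ a = κ (φ (member i a) x)
    drop : ∀ W s → s ℤ.+ ℤ.- W ℤ.* 0ℤ ≡ s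
    drop = solve-∀
    on-line : sum χ ≡ δ (class (lineOf x)) i
    on-line with class (lineOf x) Fin.≟ i
    ... | yes refl = trans (sum-select χ (position (lineOf x)) off)
                       (trans (cong κ (trans (cong (λ ℓ → φ ℓ x) (member-class (lineOf x))) (proj₂ (line x)))) (δ-same 0#))
      where
      off : ∀ a → a ≢ position (lineOf x) → χ a ≡ 0ℤ
      off a a≢ = δ-diff λ φ≡0 → a≢ (trans (sym (position-member _ a)) (cong position (line-unique x≢0 φ≡0)))
    ... | no class≢i = sum-all-zero χ λ a → δ-diff λ φ≡0 →
      class≢i (trans (cong class (sym (line-unique x≢0 φ≡0))) (class-member i a))

  conv-cong : ∀ {f f′ g g′} → f ≗ f′ → g ≗ g′ → ∀ x → conv f g x ≡ conv f′ g′ x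
  conv-cong f≗f′ g≗g′ x = sum-cong-≗ λ i → cong₂ ℤ._*_ (f≗f′ (elem i)) (g≗g′ _)

  ∑ₚ-linear : ∀ (F : Fin w → Point → ℤ) c G →
              ∑ₚ (λ y → sum (λ a → F a y) ℤ.+ c ℤ.* G y) ≡ sum (λ a → ∑ₚ (F a)) ℤ.+ c ℤ.* ∑ₚ G
  ∑ₚ-linear F c G = begin
    ∑ₚ (λ y → sum (λ a → F a y) ℤ.+ c ℤ.* G y)
      ≡⟨ ∑-distrib-+ (λ i → sum (λ a → F a (elem i))) (λ i → c ℤ.* G (elem i)) ⟩
    ∑ₚ (λ y → sum (λ a → F a y)) ℤ.+ ∑ₚ (λ y → c ℤ.* G y)
      ≡⟨ cong₂ ℤ._+_ (∑-comm (λ i a → F a (elem i))) (sym (*-distribˡ-sum c (λ i → G (elem i)))) ⟩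
    sum (λ a → ∑ₚ (F a)) ℤ.+ c ℤ.* ∑ₚ G
      ∎

  conv-D : ∀ f i x → conv f (D i) x ≡ sum (λ a → conv f (κ ∘ φ (member i a)) x) ℤ.+ ℤ.- W ℤ.* f x
  conv-D f i x = begin
    ∑ₚ (λ y → f y ℤ.* D i (x -ₚ y))
      ≡⟨ sum-cong-≗ (λ k → expand (elem k)) ⟩
    ∑ₚ (λ y → sum (λ a → f y ℤ.* κ (φ (member i a) (x -ₚ y))) ℤ.+ ℤ.- W ℤ.* (f y ℤ.* ε₀ (x -ₚ y)))
      ≡⟨ ∑ₚ-linear (λ a y → f y ℤ.* κ (φ (member i a) (x -ₚ y))) (ℤ.- W) (λ y → f y ℤ.* ε₀ (x -ₚ y)) ⟩
    sum (λ a → conv f (κ ∘ φ (member i a)) x) ℤ.+ ℤ.- W ℤ.* conv f ε₀ x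
      ≡⟨ cong (λ e → sum (λ a → conv f (κ ∘ φ (member i a)) x) ℤ.+ ℤ.- W ℤ.* e) (conv-ε₀ʳ f x) ⟩
    sum (λ a → conv f (κ ∘ φ (member i a)) x) ℤ.+ ℤ.- W ℤ.* f x
      ∎
    where
    distribute : ∀ f s W e → f ℤ.* (s ℤ.+ ℤ.- W ℤ.* e) ≡ f ℤ.* s ℤ.+ ℤ.- W ℤ.* (f ℤ.* e)
    distribute = solve-∀
    expand : ∀ y → f y ℤ.* D i (x -ₚ y) ≡
             sum (λ a → f y ℤ.* κ (φ (member i a) (x -ₚ y))) ℤ.+ ℤ.- W ℤ.* (f y ℤ.* ε₀ (x -ₚ y))
    expand y = trans (distribute (f y) (sum (λ a → κ (φ (member i a) (x -ₚ y)))) W (ε₀ (x -ₚ y)))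
      (cong (ℤ._+ ℤ.- W ℤ.* (f y ℤ.* ε₀ (x -ₚ y))) (*-distribˡ-sum (f y) (λ a → κ (φ (member i a) (x -ₚ y)))))

  D-conv : ∀ i g x → conv (D i) g x ≡ sum (λ a → conv (κ ∘ φ (member i a)) g x) ℤ.+ ℤ.- W ℤ.* g x
  D-conv i g x = begin
    ∑ₚ (λ y → D i y ℤ.* g (x -ₚ y))
      ≡⟨ sum-cong-≗ (λ k → expand (elem k)) ⟩
    ∑ₚ (λ y → sum (λ a → κ (φ (member i a) y) ℤ.* g (x -ₚ y)) ℤ.+ ℤ.- W ℤ.* (ε₀ y ℤ.* g (x -ₚ y)))
      ≡⟨ ∑ₚ-linear (λ a y → κ (φ (member i a) y) ℤ.* g (x -ₚ y)) (ℤ.- W) (λ y → ε₀ y ℤ.* g (x -ₚ y)) ⟩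
    sum (λ a → conv (κ ∘ φ (member i a)) g x) ℤ.+ ℤ.- W ℤ.* conv ε₀ g x
      ≡⟨ cong (λ e → sum (λ a → conv (κ ∘ φ (member i a)) g x) ℤ.+ ℤ.- W ℤ.* e) (conv-ε₀ˡ g x) ⟩
    sum (λ a → conv (κ ∘ φ (member i a)) g x) ℤ.+ ℤ.- W ℤ.* g x
      ∎
    where
    distribute : ∀ s W e g → (s ℤ.+ ℤ.- W ℤ.* e) ℤ.* g ≡ s ℤ.* g ℤ.+ ℤ.- W ℤ.* (e ℤ.* g)
    distribute = solve-∀
    expand : ∀ y → D i y ℤ.* g (x -ₚ y) ≡
             sum (λ a → κ (φ (member i a) y) ℤ.* g (x -ₚ y)) ℤ.+ ℤ.- W ℤ.* (ε₀ y ℤ.* g (x -ₚ y))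
    expand y = trans (distribute (sum (λ a → κ (φ (member i a) y))) W (ε₀ y) (g (x -ₚ y)))
      (cong (ℤ._+ ℤ.- W ℤ.* (ε₀ y ℤ.* g (x -ₚ y))) (*-distribʳ-sum (g (x -ₚ y)) (λ a → κ (φ (member i a) y))))

  -- The line's own direction gives Q c, each of the other w - 1 lines of the class gives `sum f`,
  -- and the removed copies of 0 give -W c. It is used with `κ` on the diagonal and with `h` off it.
  conv-line-D : ∀ i a (f : Fin q → ℤ) x → let c = f (φ (member i a) x) in
                conv (f ∘ φ (member i a)) (D i) x ≡ Q ℤ.* c ℤ.+ (W ℤ.- 1ℤ) ℤ.* sum f ℤ.+ ℤ.- W ℤ.* c
  conv-line-D i a f x = trans (conv-D (f ∘ φ (member i a)) i x)
    (cong (ℤ._+ ℤ.- W ℤ.* f (φ (member i a) x))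
      (sum-one-exception (λ b → conv (f ∘ φ (member i a)) (κ ∘ φ (member i b)) x) a
        (conv-same (member i a) f x)
        (λ b b≢a → trans (conv-distinct (members-of-class (b≢a ∘ sym)) f κ x)
          (trans (cong (sum f ℤ.*_) sum-κ) (ℤ.*-identityʳ (sum f))))))

  conv-T-T : ∀ {l i} → l ≢ i → ∀ x → conv (T′ l) (T′ i) x ≡ Z₂ ℤ.* Z₂
  conv-T-T l≢i x = trans (conv-distinct (members-of-classes l≢i) h h x) (cong₂ ℤ._*_ (sum-h l≢i) (sum-h l≢i))

  conv-D-T : ∀ {j i} → j ≢ i → ∀ x → conv (D j) (T′ i) x ≡ W ℤ.* Z₂ ℤ.+ ℤ.- W ℤ.* T′ i x
  conv-D-T {j} {i} j≢i x = trans (D-conv j (T′ i) x) (cong (ℤ._+ ℤ.- W ℤ.* T′ i x) (begin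
    sum (λ a → conv (κ ∘ φ (member j a)) (T′ i) x)  ≡⟨ sum-cong-≗ (λ a → begin
      conv (κ ∘ φ (member j a)) (T′ i) x    ≡⟨ conv-distinct (members-of-classes j≢i) κ h x ⟩
      sum κ ℤ.* sum h                       ≡⟨ cong₂ ℤ._*_ sum-κ (sum-h j≢i) ⟩
      1ℤ ℤ.* Z₂                             ≡⟨ ℤ.*-identityˡ Z₂ ⟩
      Z₂                                    ∎) ⟩
    sum {w} (λ _ → Z₂)                              ≡⟨ sum-const w Z₂ ⟩
    W ℤ.* Z₂                                        ∎))

  conv-D-D : ∀ i x → conv (D i) (D i) x ≡
             (Q ℤ.- + 2 ℤ.* W) ℤ.* D i x ℤ.+ (W ℤ.* W ℤ.- W) ℤ.+ (Q ℤ.* W ℤ.- W ℤ.* W) ℤ.* ε₀ x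
  conv-D-D i x = begin
    conv (D i) (D i) x
      ≡⟨ D-conv i (D i) x ⟩
    sum (λ a → conv (κ ∘ φ (member i a)) (D i) x) ℤ.+ ℤ.- W ℤ.* D i x
      ≡⟨ cong (ℤ._+ ℤ.- W ℤ.* D i x) (sum-cong-≗ (λ a → trans (conv-line-D i a κ x)
           (trans (cong (λ e → Q ℤ.* χ a ℤ.+ (W ℤ.- 1ℤ) ℤ.* e ℤ.+ ℤ.- W ℤ.* χ a) sum-κ) (collect Q W (χ a))))) ⟩
    sum (λ a → (W ℤ.- 1ℤ) ℤ.+ (Q ℤ.- W) ℤ.* χ a) ℤ.+ ℤ.- W ℤ.* D i x
      ≡⟨ cong (ℤ._+ ℤ.- W ℤ.* D i x) (trans (∑-distrib-+ (λ _ → W ℤ.- 1ℤ) (λ a → (Q ℤ.- W) ℤ.* χ a))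
           (cong₂ ℤ._+_ (sum-const w (W ℤ.- 1ℤ)) (sym (*-distribˡ-sum (Q ℤ.- W) χ)))) ⟩
    W ℤ.* (W ℤ.- 1ℤ) ℤ.+ (Q ℤ.- W) ℤ.* sum χ ℤ.+ ℤ.- W ℤ.* D i x
      ≡⟨ finish Q W (sum χ) (ε₀ x) ⟩
    (Q ℤ.- + 2 ℤ.* W) ℤ.* D i x ℤ.+ (W ℤ.* W ℤ.- W) ℤ.+ (Q ℤ.* W ℤ.- W ℤ.* W) ℤ.* ε₀ x
      ∎
    where
    χ : Fin w → ℤ
    χ a = κ (φ (member i a) x)
    collect : ∀ Q W c → Q ℤ.* c ℤ.+ (W ℤ.- 1ℤ) ℤ.* 1ℤ ℤ.+ ℤ.- W ℤ.* c ≡ (W ℤ.- 1ℤ) ℤ.+ (Q ℤ.- W) ℤ.* c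
    collect = solve-∀
    finish : ∀ Q W s e →
      W ℤ.* (W ℤ.- 1ℤ) ℤ.+ (Q ℤ.- W) ℤ.* s ℤ.+ ℤ.- W ℤ.* (s ℤ.+ ℤ.- W ℤ.* e) ≡
      (Q ℤ.- + 2 ℤ.* W) ℤ.* (s ℤ.+ ℤ.- W ℤ.* e) ℤ.+ (W ℤ.* W ℤ.- W) ℤ.+ (Q ℤ.* W ℤ.- W ℤ.* W) ℤ.* e
    finish = solve-∀

  k λ′ μ t : ℤ
  k  = (Q ℤ.- 1ℤ) ℤ.* W ℤ.+ (Z ℤ.- 1ℤ) ℤ.* Z₂ ℤ.* Q
  λ′ = Q ℤ.+ W ℤ.* W ℤ.- + 3 ℤ.* W ℤ.+ (Z ℤ.- 1ℤ) ℤ.* (Z₂ ℤ.* Z₂)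
  μ  = W ℤ.* W ℤ.- W ℤ.+ (Z ℤ.- 1ℤ) ℤ.* (Z₂ ℤ.* Z₂)
  t  = Q ℤ.* W ℤ.- W ℤ.+ (Z ℤ.- 1ℤ) ℤ.* (Z₂ ℤ.* Z₂)

  coefficient-same : ∀ i x → ⟦ S i i ⟧ ⟨$⟩ x ≡ D i x
  coefficient-same i x = trans (cong (λ A → ⟦ A ⟧ ⟨$⟩ x) (S-same i)) (⟦diagonal⟧ i x)

  coefficient-diff : ∀ {i j} → i ≢ j → ∀ x → ⟦ S i j ⟧ ⟨$⟩ x ≡ T′ i x
  coefficient-diff i≢j x = cong (λ A → ⟦ A ⟧ ⟨$⟩ x) (S-diff i≢j)

  ∑-at : ∀ {m} (f : Fin m → ℤ[G]) x → ∑ f ⟨$⟩ x ≡ sum (λ l → f l ⟨$⟩ x)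
  ∑-at {zero}  f x = refl
  ∑-at {suc m} f x = cong (ℤ._+_ (f zero ⟨$⟩ x)) (∑-at (f ∘ suc) x)

  product : ∀ i j → ∑ (λ l → ⟦ S l j ⟧ ⊛ ⟦ S i l ⟧) ≋
            μ · ⟦ full ⟧ ⊕ (λ′ ℤ.- μ) · ⟦ S i j ⟧ ⊕ (δ i j ℤ.* (t ℤ.- μ)) · ⟦ ｛ 0ₚ ｝ ⟧
  product i j x with i Fin.≟ j
  ... | yes refl = begin
    ∑ (λ l → ⟦ S l i ⟧ ⊛ ⟦ S i l ⟧) ⟨$⟩ x
      ≡⟨ ∑-at (λ l → ⟦ S l i ⟧ ⊛ ⟦ S i l ⟧) x ⟩
    sum (λ l → (⟦ S l i ⟧ ⊛ ⟦ S i l ⟧) ⟨$⟩ x)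
      ≡⟨ sum-one-exception (λ l → (⟦ S l i ⟧ ⊛ ⟦ S i l ⟧) ⟨$⟩ x) i
           (trans (conv-cong (coefficient-same i) (coefficient-same i) x) (conv-D-D i x))
           (λ l l≢i → trans (conv-cong (coefficient-diff l≢i) (coefficient-diff (l≢i ∘ sym)) x) (conv-T-T l≢i x)) ⟩
    (Q ℤ.- + 2 ℤ.* W) ℤ.* D i x ℤ.+ (W ℤ.* W ℤ.- W) ℤ.+ (Q ℤ.* W ℤ.- W ℤ.* W) ℤ.* ε₀ x ℤ.+ (Z ℤ.- 1ℤ) ℤ.* (Z₂ ℤ.* Z₂)
      ≡⟨ finish Q W Z (Z₂ ℤ.* Z₂) (D i x) (ε₀ x) ⟩
    μ ℤ.* 1ℤ ℤ.+ (λ′ ℤ.- μ) ℤ.* D i x ℤ.+ (1ℤ ℤ.* (t ℤ.- μ)) ℤ.* ε₀ x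
      ≡⟨ cong (λ e → μ ℤ.* 1ℤ ℤ.+ (λ′ ℤ.- μ) ℤ.* e ℤ.+ (1ℤ ℤ.* (t ℤ.- μ)) ℤ.* ε₀ x) (⟦diagonal⟧ i x) ⟨
    μ ℤ.* 1ℤ ℤ.+ (λ′ ℤ.- μ) ℤ.* (⟦ diagonal i ⟧ ⟨$⟩ x) ℤ.+ (1ℤ ℤ.* (t ℤ.- μ)) ℤ.* ε₀ x
      ∎
    where
    finish : ∀ Q W Z V D e →
      let β = Q ℤ.+ W ℤ.* W ℤ.- + 3 ℤ.* W ℤ.+ (Z ℤ.- 1ℤ) ℤ.* V ℤ.- (W ℤ.* W ℤ.- W ℤ.+ (Z ℤ.- 1ℤ) ℤ.* V)
          γ = Q ℤ.* W ℤ.- W ℤ.+ (Z ℤ.- 1ℤ) ℤ.* V ℤ.- (W ℤ.* W ℤ.- W ℤ.+ (Z ℤ.- 1ℤ) ℤ.* V)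
      in (Q ℤ.- + 2 ℤ.* W) ℤ.* D ℤ.+ (W ℤ.* W ℤ.- W) ℤ.+ (Q ℤ.* W ℤ.- W ℤ.* W) ℤ.* e ℤ.+ (Z ℤ.- 1ℤ) ℤ.* V ≡
         (W ℤ.* W ℤ.- W ℤ.+ (Z ℤ.- 1ℤ) ℤ.* V) ℤ.* 1ℤ ℤ.+ β ℤ.* D ℤ.+ (1ℤ ℤ.* γ) ℤ.* e
    finish = solve-∀
  ... | no i≢j = begin
    ∑ (λ l → ⟦ S l j ⟧ ⊛ ⟦ S i l ⟧) ⟨$⟩ x
      ≡⟨ ∑-at (λ l → ⟦ S l j ⟧ ⊛ ⟦ S i l ⟧) x ⟩
    sum (λ l → (⟦ S l j ⟧ ⊛ ⟦ S i l ⟧) ⟨$⟩ x)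
      ≡⟨ sum-two-exceptions (λ l → (⟦ S l j ⟧ ⊛ ⟦ S i l ⟧) ⟨$⟩ x) i j i≢j
           (trans (conv-cong (coefficient-diff i≢j) (coefficient-same i) x)
             (trans (conv-line-D i first h x) (cong (λ e → Q ℤ.* T′ i x ℤ.+ (W ℤ.- 1ℤ) ℤ.* e ℤ.+ ℤ.- W ℤ.* T′ i x) (sum-h i≢j))))
           (trans (conv-cong (coefficient-same j) (coefficient-diff i≢j) x) (conv-D-T (i≢j ∘ sym) x))
           (λ l l≢i l≢j → trans (conv-cong (coefficient-diff l≢j) (coefficient-diff (l≢i ∘ sym)) x) (conv-T-T l≢i x)) ⟩
    Q ℤ.* T′ i x ℤ.+ (W ℤ.- 1ℤ) ℤ.* Z₂ ℤ.+ ℤ.- W ℤ.* T′ i x ℤ.+ (W ℤ.* Z₂ ℤ.+ ℤ.- W ℤ.* T′ i x) ℤ.+ (Z ℤ.- + 2) ℤ.* (Z₂ ℤ.* Z₂)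
      ≡⟨ expose Q W Z Z₂ (T′ i x) ⟩
    (Q ℤ.- + 2 ℤ.* W) ℤ.* T′ i x ℤ.+ (Z ℤ.- + 2) ℤ.* (Z₂ ℤ.* Z₂) ℤ.+ (+ 2 ℤ.* W ℤ.- 1ℤ) ℤ.* Z₂
      -- Here the choice of z₂ enters: (2w - 1) z₂ supplies the w² - w and the one z₂² still missing
      -- from μ.
      ≡⟨ cong (ℤ._+_ ((Q ℤ.- + 2 ℤ.* W) ℤ.* T′ i x ℤ.+ (Z ℤ.- + 2) ℤ.* (Z₂ ℤ.* Z₂))) quadratic ⟨
    (Q ℤ.- + 2 ℤ.* W) ℤ.* T′ i x ℤ.+ (Z ℤ.- + 2) ℤ.* (Z₂ ℤ.* Z₂) ℤ.+ (Z₂ ℤ.* Z₂ ℤ.+ W ℤ.* W ℤ.- W)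
      ≡⟨ finish Q W Z (Z₂ ℤ.* Z₂) (t ℤ.- μ) (T′ i x) (ε₀ x) ⟩
    μ ℤ.* 1ℤ ℤ.+ (λ′ ℤ.- μ) ℤ.* T′ i x ℤ.+ (0ℤ ℤ.* (t ℤ.- μ)) ℤ.* ε₀ x
      ∎
    where
    expose : ∀ Q W Z Y T →
      Q ℤ.* T ℤ.+ (W ℤ.- 1ℤ) ℤ.* Y ℤ.+ ℤ.- W ℤ.* T ℤ.+ (W ℤ.* Y ℤ.+ ℤ.- W ℤ.* T) ℤ.+ (Z ℤ.- + 2) ℤ.* (Y ℤ.* Y) ≡
      (Q ℤ.- + 2 ℤ.* W) ℤ.* T ℤ.+ (Z ℤ.- + 2) ℤ.* (Y ℤ.* Y) ℤ.+ (+ 2 ℤ.* W ℤ.- 1ℤ) ℤ.* Y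
    expose = solve-∀
    finish : ∀ Q W Z V γ T e →
      let β = Q ℤ.+ W ℤ.* W ℤ.- + 3 ℤ.* W ℤ.+ (Z ℤ.- 1ℤ) ℤ.* V ℤ.- (W ℤ.* W ℤ.- W ℤ.+ (Z ℤ.- 1ℤ) ℤ.* V)
      in (Q ℤ.- + 2 ℤ.* W) ℤ.* T ℤ.+ (Z ℤ.- + 2) ℤ.* V ℤ.+ (V ℤ.+ W ℤ.* W ℤ.- W) ≡
         (W ℤ.* W ℤ.- W ℤ.+ (Z ℤ.- 1ℤ) ℤ.* V) ℤ.* 1ℤ ℤ.+ β ℤ.* T ℤ.+ (0ℤ ℤ.* γ) ℤ.* e
    finish = solve-∀

  +size : ∀ A → + size A ≡ ∑ₚ (λ x → ⟦ A ⟧ ⟨$⟩ x)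
  +size A = trans (pos-sum (λ i → if A ⟨$⟩ elem i then 1 else 0)) (sum-cong-≗ (λ i → pos-if (A ⟨$⟩ elem i)))
    where
    pos-if : ∀ b → + (if b then 1 else 0) ≡ indicator b
    pos-if false = refl
    pos-if true  = refl

  +size-same : ∀ i → + size (S i i) ≡ (Q ℤ.- 1ℤ) ℤ.* W
  +size-same i = begin
    + size (S i i)       ≡⟨ +size (S i i) ⟩
    ∑ₚ (λ x → ⟦ S i i ⟧ ⟨$⟩ x)  ≡⟨ sum-cong-≗ (λ k → coefficient-same i (elem k)) ⟩
    ∑ₚ (D i)             ≡⟨ ∑ₚ-linear (λ a x → κ (φ (member i a) x)) (ℤ.- W) ε₀ ⟩
    sum (λ a → ∑ₚ (κ ∘ φ (member i a))) ℤ.+ ℤ.- W ℤ.* ∑ₚ ε₀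
      ≡⟨ cong₂ (λ u v → u ℤ.+ ℤ.- W ℤ.* v)
           (trans (sum-cong-≗ (λ a → trans (∑ₚ-φ (member i a) κ) (trans (cong (Q ℤ.*_) sum-κ) (ℤ.*-identityʳ Q)))) (sum-const w Q))
           ∑ₚ-ε₀ ⟩
    W ℤ.* Q ℤ.+ ℤ.- W ℤ.* 1ℤ  ≡⟨ finish Q W ⟩
    (Q ℤ.- 1ℤ) ℤ.* W     ∎
    where
    finish : ∀ Q W → W ℤ.* Q ℤ.+ ℤ.- W ℤ.* 1ℤ ≡ (Q ℤ.- 1ℤ) ℤ.* W
    finish = solve-∀

  +size-diff : ∀ {i j} → i ≢ j → + size (S i j) ≡ Q ℤ.* Z₂
  +size-diff {i} {j} i≢j = begin
    + size (S i j)              ≡⟨ +size (S i j) ⟩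
    ∑ₚ (λ x → ⟦ S i j ⟧ ⟨$⟩ x)  ≡⟨ sum-cong-≗ (λ k → coefficient-diff i≢j (elem k)) ⟩
    ∑ₚ (T′ i)                   ≡⟨ ∑ₚ-φ (member i first) h ⟩
    Q ℤ.* sum h                 ≡⟨ cong (Q ℤ.*_) (sum-h i≢j) ⟩
    Q ℤ.* Z₂                    ∎

  total-size : ∀ (f : Fin z → ℕ) i → + f i ≡ (Q ℤ.- 1ℤ) ℤ.* W → (∀ j → j ≢ i → + f j ≡ Q ℤ.* Z₂) →
               + CommutativeMonoidSum.sum ℕ.+-0-commutativeMonoid f ≡ k
  total-size f i same diff = trans (pos-sum f) (trans (sum-one-exception (+_ ∘ f) i same diff) (finish Q W Z Z₂))
    where
    finish : ∀ Q W Z Y → (Q ℤ.- 1ℤ) ℤ.* W ℤ.+ (Z ℤ.- 1ℤ) ℤ.* (Q ℤ.* Y) ≡ (Q ℤ.- 1ℤ) ℤ.* W ℤ.+ (Z ℤ.- 1ℤ) ℤ.* Y ℤ.* Q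
    finish = solve-∀

  ∈-diagonal⁻ : ∀ {i x} → x ∈ S i i → x ≢ 0ₚ × class (lineOf x) ≡ i
  ∈-diagonal⁻ {i} {x} x∈S = separate (x ≟ 0ₚ) (class (lineOf x) Fin.≟ i) (subst (x ∈_) (S-same i) x∈S)
    where
    separate : ∀ {A B : Set} (A? : Dec A) (B? : Dec B) → T (not (does A?) ∧ does B?) → ¬ A × B
    separate (no ¬a) (yes b) _ = ¬a , b

  ∈-diagonal⁺ : ∀ {x} → x ≢ 0ₚ → x ∈ S (class (lineOf x)) (class (lineOf x))
  ∈-diagonal⁺ {x} x≢0 = subst (x ∈_) (sym (S-same c)) (subst T (sym inside) _)
    where
    c = class (lineOf x)
    inside : not (does (x ≟ 0ₚ)) ∧ does (c Fin.≟ c) ≡ true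
    inside = cong₂ (λ a b → not a ∧ b) (dec-false (x ≟ 0ₚ) x≢0) (dec-true (c Fin.≟ c) refl)

  point-on : ∀ ℓ → ∃ λ x → x ≢ 0ₚ × φ ℓ x ≡ 0#
  point-on zero    = (0# , 1#) , (λ eq → 1≢0 (cong proj₂ eq)) , refl
  point-on (suc m) = (1# , m) , (λ eq → 1≢0 (cong proj₁ eq)) ,
    trans (cong (λ e → m + - e) (CommutativeRing.*-identityʳ fieldRing m)) (CommutativeRing.-‿inverseʳ fieldRing m)

  family : PartialSumFamily z (q ℕ.* q) k λ′ μ t
  family = record
    { group    = planeGroup
    ; S        = S
    ; 0∉S      = λ i 0∈S → proj₁ (∈-diagonal⁻ {i} 0∈S) refl
    ; row-size = λ i → total-size (λ j → size (S i j)) i (+size-same i) (λ j j≢i → +size-diff (j≢i ∘ sym))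
    ; col-size = λ i → total-size (λ j → size (S j i)) i (+size-same i) (λ j → +size-diff)
    ; product  = product
    }

  uniform : Uniform family
  uniform = record
    { diagonal-size     = λ i i′ → ℤ.+-injective (trans (+size-same i) (sym (+size-same i′)))
    ; off-diagonal-size = λ i j i′ j′ i≢j i′≢j′ → ℤ.+-injective (trans (+size-diff i≢j) (sym (+size-diff i′≢j′)))
    ; nonempty          = nonempty
    ; disjoint          = λ i i′ i≢i′ x (x∈S , x∈S′) →
        i≢i′ (trans (sym (proj₂ (∈-diagonal⁻ {i} x∈S))) (proj₂ (∈-diagonal⁻ {i′} x∈S′)))
    ; covers            = λ x → mk⇔ (λ x≢0 → class (lineOf x) , ∈-diagonal⁺ x≢0) (λ (i , x∈S) → proj₁ (∈-diagonal⁻ {i} x∈S))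
    }
    where
    nonempty : ∀ i → ∃ λ x → x ∈ S i i
    nonempty i with point-on (member i first)
    ... | x , x≢0 , φ≡0 = x , subst (λ c → x ∈ S c c)
      (trans (cong class (sym (line-unique x≢0 φ≡0))) (class-member i first)) (∈-diagonal⁺ x≢0)

-- Arithmetic of the parameters, and the theorem.

2≤size : ∀ {z} {i j : Fin z} → i ≢ j → 2 ℕ.≤ z
2≤size {suc zero}    {zero} {zero} i≢j = contradiction refl i≢j
2≤size {suc (suc z)} _ = s≤s (s≤s z≤n)

-- Two classes force w + 1 ≤ 2w ≤ zw = q + 1.
zw≡1+q⇒w≤q : ∀ {q w z} → .{{_ : NonZero w}} → z ℕ.* w ≡ suc q → {i j : Fin z} → i ≢ j → w ℕ.≤ q
zw≡1+q⇒w≤q {q} {w} {z} zw≡1+q i≢j = ℕ.s≤s⁻¹ (ℕR.begin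
  suc w      ℕR.≤⟨ ℕ.+-monoˡ-≤ w (ℕ.>-nonZero⁻¹ w) ⟩
  w ℕ.+ w    ℕR.≡⟨ cong (w ℕ.+_) (ℕ.+-identityʳ w) ⟨
  2 ℕ.* w    ℕR.≤⟨ ℕ.*-monoˡ-≤ w (2≤size i≢j) ⟩
  z ℕ.* w    ℕR.≡⟨ zw≡1+q ⟩
  suc q      ℕR.∎)
  where module ℕR = ℕ.≤-Reasoning

-- The expanded form of (z - w)(z - w + 1) = 0. As w is nonzero, the truncated w ∸ 1 is the true w -
-- 1.
[z-w][z-w+1]≡0 : ∀ w z → .{{_ : NonZero w}} → z ≡ w ℕ.∸ 1 ⊎ z ≡ w →
                 + z ℤ.* + z ℤ.+ + w ℤ.* + w ℤ.- + w ≡ (+ 2 ℤ.* + w ℤ.- 1ℤ) ℤ.* + z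
[z-w][z-w+1]≡0 (suc w) z (inj₁ refl) = lemma (+ w)
  where
  lemma : ∀ Y → Y ℤ.* Y ℤ.+ (1ℤ ℤ.+ Y) ℤ.* (1ℤ ℤ.+ Y) ℤ.- (1ℤ ℤ.+ Y) ≡ (+ 2 ℤ.* (1ℤ ℤ.+ Y) ℤ.- 1ℤ) ℤ.* Y
  lemma = solve-∀
[z-w][z-w+1]≡0 w z (inj₂ refl) = lemma (+ w)
  where
  lemma : ∀ W → W ℤ.* W ℤ.+ W ℤ.* W ℤ.- W ≡ (+ 2 ℤ.* W ℤ.- 1ℤ) ℤ.* W
  lemma = solve-∀

open import Data.Integer.Base using (_+_; _-_; _*_)

corollary3p5 :
    ∀ (p d w z₂ : ℕ) → Prime p → .{{_ : NonZero d}} → .{{_ : NonZero w}} →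
    w ∣ p ℕ.^ d ℕ.+ 1 →
    z₂ ≡ w ℕ.∸ 1 ⊎ z₂ ≡ w →
    let z₁ = (p ℕ.^ d ℕ.+ 1) ℕ./ w
        q = + (p ℕ.^ d)
        W = + w
        Z₁ = + z₁
        Z₂ = + z₂
        k = (q - + 1) * W + (Z₁ - + 1) * Z₂ * q
        λ′ = q + W * W - + 3 * W + (Z₁ - + 1) * (Z₂ * Z₂)
        μ = W * W - W + (Z₁ - + 1) * (Z₂ * Z₂)
        t = q * W - W + (Z₁ - + 1) * (Z₂ * Z₂)
    in Σ (PartialSumFamily z₁ (p ℕ.^ (2 ℕ.* d)) k λ′ μ t) Uniform
corollary3p5 p d w z₂ prime-p w∣q+1 z₂-choice =
  -- The plane is built with order q * q; only this index has to be rewritten as p^(2d).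
  subst (λ n → Σ (PartialSumFamily ((q ℕ.+ 1) ℕ./ w) n k λ′ μ t) Uniform) q*q≡p^[2d] (family , uniform)
  where
  q = p ℕ.^ d
  z₁w≡1+q : (q ℕ.+ 1) ℕ./ w ℕ.* w ≡ suc q
  z₁w≡1+q = trans (m/n*n≡m w∣q+1) (ℕ.+-comm q 1)
  z₂≤w : z₂ ℕ.≤ w
  z₂≤w = Sum.[ (λ { refl → ℕ.m∸n≤m w 1 }) , ℕ.≤-reflexive ] z₂-choice
  q*q≡p^[2d] : q ℕ.* q ≡ p ℕ.^ (2 ℕ.* d)
  q*q≡p^[2d] = trans (sym (ℕ.^-distribˡ-+-* p d d)) (cong (λ e → p ℕ.^ (d ℕ.+ e)) (sym (ℕ.+-identityʳ d)))
  open Family (finiteField d prime-p) {(q ℕ.+ 1) ℕ./ w} {w} {z₂} z₁w≡1+q (fromℕ< (ℕ.>-nonZero⁻¹ w))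
    (λ i≢j → ℕ.≤-trans z₂≤w (zw≡1+q⇒w≤q {q} {w} z₁w≡1+q i≢j)) ([z-w][z-w+1]≡0 w z₂ z₂-choice)
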